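{- Let $a_9(n)$ be defined by \[\sum_{n\geq 0}a_9(n)q^n=\frac{f_9f_{18}}{f_1f_2},\qquad f_k=\prod_{m=1}^{\infty}(1-q^{km}).\] Then for every integer $\alpha\geq 0$ and every integer $n\geq 0$, \[a_9\left(3^{\alpha+1}n+3^{\alpha+1}-1\right)\equiv 0 \pmod{3^{\alpha+1}}.\]
   Context: $a_9(n)$ is the number of 9-regular cubic partitions of $n$; its generating function is as given, where $f_k=(q^k;q^k)_\infty$. -}

module Defs where

open import Data.Nat.Base as ℕ using (ℕ; zero; suc; z≤n; s≤s)
import Data.Nat.Properties as ℕ
open import Data.Fin.Base using (toℕ; zero; suc)
open import Data.Integer.Base using (ℤ; 0ℤ; 1ℤ; _+_; _-_; _*_)
open import Data.Integer.Properties
  using (+-*-semiring; *-identityˡ; *-identityʳ; *-zeroˡ; +-identityʳ; +-comm; +-assoc; +-inverseˡ)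
open import Algebra.Properties.Semiring.Sum +-*-semiring
  using (sum; sum⁺-syntax; sum-cong-≗; sum-replicate-zero)
open import Relation.Nullary using (yes; no; contradiction)
open import Relation.Binary.PropositionalEquality
  using (_≡_; refl; sym; trans; cong; cong₂; _≗_; module ≡-Reasoning)

-- Formal power series over ℤ; `a n` is the coefficient of qⁿ.

Series : Set
Series = ℕ → ℤ

infixl 7 _⊛_ _⊘_

_⊛_ : Series → Series → Series
(a ⊛ b) n = ∑[ i ≤ n ] (a (toℕ i) * b (n ℕ.∸ toℕ i))

q^_ : ℕ → Series
(q^ j) n with n ℕ.≟ j
... | yes _ = 1ℤ
... | no  _ = 0ℤ

1-q^_ : ℕ → Series
(1-q^ j) n = (q^ 0) n - (q^ j) n

-- ∏_{m=1}^{N} (1 - q^{k m})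

partialProduct : ℕ → ℕ → Series
partialProduct k zero    = q^ 0
partialProduct k (suc N) = (1-q^ (k ℕ.* suc N)) ⊛ partialProduct k N

-- ∏_{m≥1} (1 - q^{k m}) for k ≥ 1.  The factors with m > n do not affect the
-- coefficient of qⁿ, so that coefficient is read off from the n-th partial
-- product; `f-limit` below shows that all later ones agree with it.

f : ℕ → Series
f k n = partialProduct k n n

-- Long division; it is the quotient of power series when the divisor has
-- constant term 1 (see `⊘-correct`), which is the only case it is used for.

_⊘_ : Series → Series → Series
(g ⊘ h) zero    = g 0
(g ⊘ h) (suc n) = ((λ m → g (suc m) - g 0 * h (suc m)) ⊘ h) n

a₉ : Series
a₉ = (f 9 ⊛ f 18) ⊘ (f 1 ⊛ f 2)

private
  x+[y-x]≡y : ∀ x y → x + (y - x) ≡ y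
  x+[y-x]≡y x y = begin
    x + (y - x)  ≡⟨ +-comm x (y - x) ⟩
    (y - x) + x  ≡⟨ +-assoc y _ x ⟩
    y + _        ≡⟨ cong (y +_) (+-inverseˡ x) ⟩
    y + 0ℤ       ≡⟨ +-identityʳ y ⟩
    y            ∎
    where open ≡-Reasoning

  q^-off : ∀ {j n} → n ℕ.< j → (q^ j) n ≡ 0ℤ
  q^-off {j} {n} n<j with n ℕ.≟ j
  ... | yes n≡j = contradiction n≡j (ℕ.<⇒≢ n<j)
  ... | no  _   = refl

  1-q^-zero : ∀ {j} → 0 ℕ.< j → (1-q^ j) 0 ≡ 1ℤ
  1-q^-zero 0<j = cong (1ℤ -_) (q^-off 0<j)

  1-q^-off : ∀ {j n} → suc n ℕ.< j → (1-q^ j) (suc n) ≡ 0ℤ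
  1-q^-off n<j = cong (0ℤ -_) (q^-off n<j)

⊘-correct : ∀ g h → h 0 ≡ 1ℤ → (g ⊘ h) ⊛ h ≗ g
⊘-correct g h h₀ zero = begin
  g 0 * h 0 + 0ℤ  ≡⟨ +-identityʳ _ ⟩
  g 0 * h 0       ≡⟨ cong (g 0 *_) h₀ ⟩
  g 0 * 1ℤ        ≡⟨ *-identityʳ (g 0) ⟩
  g 0             ∎
  where open ≡-Reasoning
⊘-correct g h h₀ (suc n) =
  trans (cong (g 0 * h (suc n) +_) (⊘-correct (λ m → g (suc m) - g 0 * h (suc m)) h h₀ n))
        (x+[y-x]≡y (g 0 * h (suc n)) (g (suc n)))

⊛-1-q^-low : ∀ {j n} (a : Series) → n ℕ.< j → ((1-q^ j) ⊛ a) n ≡ a n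
⊛-1-q^-low {j} {n} a n<j = begin
  (1-q^ j) 0 * a n + sum {n} tail  ≡⟨ cong₂ _+_ (cong (_* a n) (1-q^-zero (ℕ.≤-<-trans z≤n n<j)))
                                           (trans (sum-cong-≗ tail≗0) (sum-replicate-zero n)) ⟩
  1ℤ * a n + 0ℤ                    ≡⟨ +-identityʳ _ ⟩
  1ℤ * a n                         ≡⟨ *-identityˡ (a n) ⟩
  a n                              ∎
  where
  open ≡-Reasoning
  open import Data.Fin.Properties using (toℕ<n)
  tail = λ i → (1-q^ j) (suc (toℕ i)) * a (n ℕ.∸ suc (toℕ i))
  tail≗0 : tail ≗ λ _ → 0ℤ
  tail≗0 i = trans (cong (_* a (n ℕ.∸ suc (toℕ i))) (1-q^-off (ℕ.≤-<-trans (toℕ<n i) n<j)))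
                   (*-zeroˡ (a (n ℕ.∸ suc (toℕ i))))

f-limit : ∀ k .{{_ : ℕ.NonZero k}} n d → partialProduct k (d ℕ.+ n) n ≡ f k n
f-limit k n zero    = refl
f-limit k n (suc d) = trans
  (⊛-1-q^-low (partialProduct k (d ℕ.+ n))
    (ℕ.≤-trans (s≤s (ℕ.m≤n+m n d)) (ℕ.m≤n*m (suc (d ℕ.+ n)) k)))
  (f-limit k n d)

a₉-generating : a₉ ⊛ (f 1 ⊛ f 2) ≗ f 9 ⊛ f 18
a₉-generating = ⊘-correct (f 9 ⊛ f 18) (f 1 ⊛ f 2) refl

{-# OPTIONS --safe #-}
module Submission where

-- Put E = f₁f₂, D = E(q³), F = q a₉ = q E(q⁹)/E and y = q D⁴/E⁴, and let U extract
-- the coefficients of q^{3n}.  Writing E = φ(-q) ψ(q) and splitting both theta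
-- series by exponents modulo 3 gives E = A(q³) - q E(q⁹) - 2q² B(q³) with
-- A B = D², and the product formula for E gives its norm to ℤ[[q³]].  Together
-- these say y = F + 3F² + 9F³ and F³ = y(q³)(1 + 3F + 9F²), U F = 3y and
-- U F² = 2y + 27y².  With G = 3F and z = 3y this becomes z = G + G² + G³ and
-- G³ = 9 z(q³)(1 + G + G²), so the polynomials in G without constant term contain
-- those in z, and U sends them to 3 times polynomials in z without constant term.
-- Since U F = z and 3 divides z, U^{α+1} F is divisible by 3^{α+1}.

open import Defs
open import Data.Nat.Base as ℕ using (ℕ; zero; suc; z≤n; s≤s)
import Data.Nat.Properties as ℕ
open import Data.Nat.Tactic.RingSolver using (solve-∀)
open import Data.Integer.Base using (ℤ; 0ℤ; 1ℤ; +_)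
  renaming (_+_ to _+ᶻ_; _*_ to _*ᶻ_; -_ to -ᶻ_)
import Data.Integer.Properties as ℤ
open import Data.Integer.Divisibility using (_∣_)
open import Data.Integer.Divisibility.Signed using (divides; ∣⇒∣ᵤ)
open import Data.Maybe.Base using (Maybe; just; nothing)
open import Data.Product.Base using (∃; _,_; _×_; proj₁)
open import Data.Sum.Base using (_⊎_; inj₁; inj₂)
open import Level using (0ℓ)
open import Relation.Nullary using (yes; no; contradiction)
open import Relation.Binary.PropositionalEquality
  using (_≡_; refl; sym; trans; cong; cong₂; subst; module ≡-Reasoning)
open import Algebra.Bundles using (CommutativeRing)
open import Algebra.Structures using (IsCommutativeRing)
open import Algebra.Solver.Ring.AlmostCommutativeRing
  using (fromCommutativeRing; _-Raw-AlmostCommutative⟶_)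

-- Passing from F to G = 3F is forced: U F = 3y, but U F² starts with 2y, so `U` does not send
-- polynomials in F to multiples of 3. Weighting Fⁿ by 3ⁿ repairs this, since U(G²) = 9 U(F²) = 3(2z
-- + 9z²): one factor 3 is spent on turning y into z and one survives. As the cubic for G has
-- coefficients in ℤ[[q³]], the series U(Gⁿ) satisfy a recurrence of order three, so U G and U G²
-- control all of them. Both relations for F are the single identity D⁴ = E³(1 + 3F + 9F²)E(q⁹),
-- which computes the norm of E twice: as E⁴/D from the product, and from the dissection as a cubic
-- in E. The factor q in F moves the index 3^(α+1)n + 3^(α+1) - 1 of a₉ to the multiple 3^(α+1)(n +
-- 1), where iterating `U` reads coefficients off. Identities between infinite products and theta
-- series are limits, modulo every q^K, of finite identities. The triple product is stated for two
-- series with A B = q^s, so no Laurent variable is needed.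

-- The ring of power series

infix 4 _≈_
record _≈_ (a b : Series) : Set where
  constructor pointwise
  field at : ∀ n → a n ≡ b n
open _≈_

tail : Series → Series
tail a n = a (suc n)

module _ where
  open ≡-Reasoning

  ⊛-at-cong : ∀ n {a a′ b b′} → (∀ i → i ℕ.≤ n → a i ≡ a′ i) → (∀ i → i ℕ.≤ n → b i ≡ b′ i) →
              (a ⊛ b) n ≡ (a′ ⊛ b′) n
  ⊛-at-cong zero    p r = cong (_+ᶻ 0ℤ) (cong₂ _*ᶻ_ (p 0 z≤n) (r 0 z≤n))
  ⊛-at-cong (suc n) p r = cong₂ _+ᶻ_ (cong₂ _*ᶻ_ (p 0 z≤n) (r (suc n) ℕ.≤-refl))
    (⊛-at-cong n (λ i i≤n → p (suc i) (s≤s i≤n)) (λ i i≤n → r i (ℕ.m≤n⇒m≤1+n i≤n)))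

  private
    rearrange : ∀ {w x y z} → (w +ᶻ x) +ᶻ (y +ᶻ z) ≡ (w +ᶻ y) +ᶻ (x +ᶻ z)
    rearrange {w} {x} {y} {z} = begin
      (w +ᶻ x) +ᶻ (y +ᶻ z)  ≡⟨ ℤ.+-assoc w x _ ⟩
      w +ᶻ (x +ᶻ (y +ᶻ z))  ≡⟨ cong (w +ᶻ_) (ℤ.+-assoc x y z) ⟨
      w +ᶻ ((x +ᶻ y) +ᶻ z)  ≡⟨ cong (λ t → w +ᶻ (t +ᶻ z)) (ℤ.+-comm x y) ⟩
      w +ᶻ ((y +ᶻ x) +ᶻ z)  ≡⟨ cong (w +ᶻ_) (ℤ.+-assoc y x z) ⟩
      w +ᶻ (y +ᶻ (x +ᶻ z))  ≡⟨ ℤ.+-assoc w y _ ⟨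
      (w +ᶻ y) +ᶻ (x +ᶻ z)  ∎

  -- The mirror image of the defining recursion: the convolution is split at its other end.
  -- Commutativity follows by playing the two recursions against each other.
  ⊛-suc : ∀ a b n → (a ⊛ b) (suc n) ≡ (a ⊛ tail b) n +ᶻ a (suc n) *ᶻ b 0
  ⊛-suc a b zero    = trans (cong (a 0 *ᶻ b 1 +ᶻ_) (ℤ.+-identityʳ (a 1 *ᶻ b 0)))
    (cong (_+ᶻ a 1 *ᶻ b 0) (sym (ℤ.+-identityʳ (a 0 *ᶻ b 1))))
  ⊛-suc a b (suc n) = trans (cong (a 0 *ᶻ b (suc (suc n)) +ᶻ_) (⊛-suc (tail a) b n))
    (sym (ℤ.+-assoc (a 0 *ᶻ b (suc (suc n))) _ _))

  ⊛-comm-at : ∀ n a b → (a ⊛ b) n ≡ (b ⊛ a) n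
  ⊛-comm-at zero    a b = cong (_+ᶻ 0ℤ) (ℤ.*-comm (a 0) (b 0))
  ⊛-comm-at (suc n) a b = begin
    a 0 *ᶻ b (suc n) +ᶻ (tail a ⊛ b) n  ≡⟨ ℤ.+-comm (a 0 *ᶻ b (suc n)) _ ⟩
    (tail a ⊛ b) n +ᶻ a 0 *ᶻ b (suc n)  ≡⟨ cong₂ _+ᶻ_ (⊛-comm-at n (tail a) b) (ℤ.*-comm (a 0) _) ⟩
    (b ⊛ tail a) n +ᶻ b (suc n) *ᶻ a 0  ≡⟨ ⊛-suc b a n ⟨
    (b ⊛ a) (suc n)                       ∎

  ⊛-distribʳ-at : ∀ n c a b → ((λ i → a i +ᶻ b i) ⊛ c) n ≡ (a ⊛ c) n +ᶻ (b ⊛ c) n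
  ⊛-distribʳ-at zero    c a b = trans (cong (_+ᶻ 0ℤ) (ℤ.*-distribʳ-+ (c 0) (a 0) (b 0)))
    (rearrange {a 0 *ᶻ c 0} {b 0 *ᶻ c 0} {0ℤ} {0ℤ})
  ⊛-distribʳ-at (suc n) c a b = trans
    (cong₂ _+ᶻ_ (ℤ.*-distribʳ-+ (c (suc n)) (a 0) (b 0)) (⊛-distribʳ-at n c (tail a) (tail b)))
    (rearrange {a 0 *ᶻ c (suc n)})

  ⊛-scale-at : ∀ n k a b → ((λ i → k *ᶻ a i) ⊛ b) n ≡ k *ᶻ (a ⊛ b) n
  ⊛-scale-at zero    k a b = begin
    k *ᶻ a 0 *ᶻ b 0 +ᶻ 0ℤ    ≡⟨ ℤ.+-identityʳ _ ⟩
    k *ᶻ a 0 *ᶻ b 0           ≡⟨ ℤ.*-assoc k (a 0) (b 0) ⟩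
    k *ᶻ (a 0 *ᶻ b 0)         ≡⟨ cong (k *ᶻ_) (ℤ.+-identityʳ _) ⟨
    k *ᶻ (a 0 *ᶻ b 0 +ᶻ 0ℤ)  ∎
  ⊛-scale-at (suc n) k a b = trans
    (cong₂ _+ᶻ_ (ℤ.*-assoc k (a 0) (b (suc n))) (⊛-scale-at n k (tail a) b))
    (sym (ℤ.*-distribˡ-+ k (a 0 *ᶻ b (suc n)) _))

  ⊛-assoc-at : ∀ n a b c → ((a ⊛ b) ⊛ c) n ≡ (a ⊛ (b ⊛ c)) n
  ⊛-assoc-at zero    a b c = cong (_+ᶻ 0ℤ) (begin
    (a 0 *ᶻ b 0 +ᶻ 0ℤ) *ᶻ c 0  ≡⟨ cong (_*ᶻ c 0) (ℤ.+-identityʳ (a 0 *ᶻ b 0)) ⟩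
    a 0 *ᶻ b 0 *ᶻ c 0           ≡⟨ ℤ.*-assoc (a 0) (b 0) (c 0) ⟩
    a 0 *ᶻ (b 0 *ᶻ c 0)         ≡⟨ cong (a 0 *ᶻ_) (ℤ.+-identityʳ _) ⟨
    a 0 *ᶻ (b 0 *ᶻ c 0 +ᶻ 0ℤ)  ∎)
  ⊛-assoc-at (suc n) a b c = begin
    (a 0 *ᶻ b 0 +ᶻ 0ℤ) *ᶻ c (suc n) +ᶻ (tail (a ⊛ b) ⊛ c) n
      ≡⟨ cong₂ _+ᶻ_
           (trans (cong (_*ᶻ c (suc n)) (ℤ.+-identityʳ (a 0 *ᶻ b 0))) (ℤ.*-assoc (a 0) (b 0) (c (suc n))))
           (⊛-distribʳ-at n c (λ i → a 0 *ᶻ b (suc i)) (tail a ⊛ b)) ⟩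
    a 0 *ᶻ (b 0 *ᶻ c (suc n)) +ᶻ (((λ i → a 0 *ᶻ b (suc i)) ⊛ c) n +ᶻ ((tail a ⊛ b) ⊛ c) n)
      ≡⟨ cong (a 0 *ᶻ (b 0 *ᶻ c (suc n)) +ᶻ_)
           (cong₂ _+ᶻ_ (⊛-scale-at n (a 0) (tail b) c) (⊛-assoc-at n (tail a) b c)) ⟩
    a 0 *ᶻ (b 0 *ᶻ c (suc n)) +ᶻ (a 0 *ᶻ (tail b ⊛ c) n +ᶻ (tail a ⊛ (b ⊛ c)) n)
      ≡⟨ ℤ.+-assoc (a 0 *ᶻ (b 0 *ᶻ c (suc n))) _ _ ⟨
    a 0 *ᶻ (b 0 *ᶻ c (suc n)) +ᶻ a 0 *ᶻ (tail b ⊛ c) n +ᶻ (tail a ⊛ (b ⊛ c)) n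
      ≡⟨ cong (_+ᶻ (tail a ⊛ (b ⊛ c)) n) (ℤ.*-distribˡ-+ (a 0) (b 0 *ᶻ c (suc n)) _) ⟨
    a 0 *ᶻ (b ⊛ c) (suc n) +ᶻ (tail a ⊛ (b ⊛ c)) n
      ∎

  ⊛-zeroˡ-at : ∀ n b → ((λ _ → 0ℤ) ⊛ b) n ≡ 0ℤ
  ⊛-zeroˡ-at zero    b = trans (ℤ.+-identityʳ _) (ℤ.*-zeroˡ (b 0))
  ⊛-zeroˡ-at (suc n) b = cong₂ _+ᶻ_ (ℤ.*-zeroˡ (b (suc n))) (⊛-zeroˡ-at n b)

constant : ℤ → Series
constant k zero    = k
constant k (suc _) = 0ℤ

⊛-constant-at : ∀ n k b → (constant k ⊛ b) n ≡ k *ᶻ b n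
⊛-constant-at zero    k b = ℤ.+-identityʳ _
⊛-constant-at (suc n) k b = trans (cong (k *ᶻ b (suc n) +ᶻ_) (⊛-zeroˡ-at n b)) (ℤ.+-identityʳ _)

-- Opaque copies of the operations, so that unification and the ring solver
-- treat them as injective symbols instead of unfolding the sums.

infixl 6 _+_ _-_
infixl 7 _*_
infix  8 -_

opaque
  _+_ : Series → Series → Series
  (a + b) n = a n +ᶻ b n

  _*_ : Series → Series → Series
  a * b = a ⊛ b

  -_ : Series → Series
  (- a) n = -ᶻ a n

  con : ℤ → Series
  con = constant

_-_ : Series → Series → Series
a - b = a + - b

0# 1# : Series
0# = con 0ℤ
1# = con 1ℤ

≈-refl : ∀ {a} → a ≈ a
≈-refl = pointwise λ _ → refl

≈-sym : ∀ {a b} → a ≈ b → b ≈ a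
≈-sym p = pointwise λ n → sym (at p n)

≈-trans : ∀ {a b c} → a ≈ b → b ≈ c → a ≈ c
≈-trans p r = pointwise λ n → trans (at p n) (at r n)

opaque
  unfolding _+_

  +-at : ∀ a b n → (a + b) n ≡ a n +ᶻ b n
  +-at a b n = refl

  neg-at : ∀ a n → (- a) n ≡ -ᶻ a n
  neg-at a n = refl

  con-zero : ∀ k → con k 0 ≡ k
  con-zero k = refl

  con-suc : ∀ k n → con k (suc n) ≡ 0ℤ
  con-suc k n = refl

  *-zero : ∀ a b → (a * b) 0 ≡ a 0 *ᶻ b 0
  *-zero a b = ℤ.+-identityʳ (a 0 *ᶻ b 0)

  *-suc : ∀ a b n → (a * b) (suc n) ≡ a 0 *ᶻ b (suc n) +ᶻ (tail a * b) n
  *-suc a b n = refl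

  con-* : ∀ k a n → (con k * a) n ≡ k *ᶻ a n
  con-* k a n = ⊛-constant-at n k a

  *-⊛ : ∀ a b n → (a * b) n ≡ (a ⊛ b) n
  *-⊛ a b n = refl

  isCommutativeRing : IsCommutativeRing _≈_ _+_ _*_ -_ 0# 1#
  isCommutativeRing = record
    { isRing = record
      { +-isAbelianGroup = record
        { isGroup = record
          { isMonoid = record
            { isSemigroup = record
              { isMagma = record
                { isEquivalence = record { refl = ≈-refl ; sym = ≈-sym ; trans = ≈-trans }
                ; ∙-cong = λ p r → pointwise λ n → cong₂ _+ᶻ_ (at p n) (at r n)
                }
              ; assoc = λ a b c → pointwise λ n → ℤ.+-assoc (a n) (b n) (c n)
              }
            ; identity = (λ a → pointwise λ n → trans (cong (_+ᶻ a n) (zero-at n)) (ℤ.+-identityˡ _))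
                       , (λ a → pointwise λ n → trans (cong (a n +ᶻ_) (zero-at n)) (ℤ.+-identityʳ _))
            }
          ; inverse = (λ a → pointwise λ n → trans (ℤ.+-inverseˡ (a n)) (sym (zero-at n)))
                    , (λ a → pointwise λ n → trans (ℤ.+-inverseʳ (a n)) (sym (zero-at n)))
          ; ⁻¹-cong = λ p → pointwise λ n → cong -ᶻ_ (at p n)
          }
        ; comm = λ a b → pointwise λ n → ℤ.+-comm (a n) (b n)
        }
      ; *-cong = λ p r → pointwise λ n → ⊛-at-cong n (λ i _ → at p i) (λ i _ → at r i)
      ; *-assoc = λ a b c → pointwise λ n → ⊛-assoc-at n a b c
      ; *-identity = (λ a → pointwise (one-⊛ a))
                   , (λ a → pointwise λ n → trans (⊛-comm-at n a (constant 1ℤ)) (one-⊛ a n))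
      ; distrib = (λ a b c → pointwise λ n → trans (⊛-comm-at n a (b + c))
                     (trans (⊛-distribʳ-at n a b c) (cong₂ _+ᶻ_ (⊛-comm-at n b a) (⊛-comm-at n c a))))
                , (λ a b c → pointwise λ n → ⊛-distribʳ-at n a b c)
      }
    ; *-comm = λ a b → pointwise λ n → ⊛-comm-at n a b
    }
    where
    zero-at : ∀ n → constant 0ℤ n ≡ 0ℤ
    zero-at zero    = refl
    zero-at (suc n) = refl
    one-⊛ : ∀ a n → (constant 1ℤ ⊛ a) n ≡ a n
    one-⊛ a n = trans (⊛-constant-at n 1ℤ a) (ℤ.*-identityˡ (a n))

commutativeRing : CommutativeRing 0ℓ 0ℓ
commutativeRing = record { isCommutativeRing = isCommutativeRing }

open CommutativeRing commutativeRing
  using (setoid; +-cong; *-cong; *-assoc; *-comm; *-identityˡ; *-identityʳ; +-identityˡ; +-identityʳ; zeroʳ; zeroˡ; -‿cong; +-comm)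
  renaming (reflexive to ≈-reflexive)

private
  -- Numerals are interpreted through the ring map ℤ → ℤ[[q]], so that the solver computes with the
  -- coefficients 3, 9 and 27.
  con-homomorphism : CommutativeRing.rawRing ℤ.+-*-commutativeRing
                     -Raw-AlmostCommutative⟶ fromCommutativeRing commutativeRing
  con-homomorphism = record
    { ⟦_⟧    = con
    ; +-homo = λ j k → pointwise (+-homo j k)
    ; *-homo = λ j k → pointwise (*-homo j k)
    ; -‿homo = λ k → pointwise (-‿homo k)
    ; 0-homo = ≈-refl
    ; 1-homo = ≈-refl
    }
    where
    +-homo : ∀ j k n → con (j +ᶻ k) n ≡ (con j + con k) n
    +-homo j k zero    = trans (con-zero (j +ᶻ k))
      (sym (trans (+-at (con j) (con k) 0) (cong₂ _+ᶻ_ (con-zero j) (con-zero k))))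
    +-homo j k (suc n) = trans (con-suc (j +ᶻ k) n)
      (sym (trans (+-at (con j) (con k) (suc n)) (cong₂ _+ᶻ_ (con-suc j n) (con-suc k n))))
    *-homo : ∀ j k n → con (j *ᶻ k) n ≡ (con j * con k) n
    *-homo j k zero    = trans (con-zero (j *ᶻ k))
      (sym (trans (con-* j (con k) 0) (cong (j *ᶻ_) (con-zero k))))
    *-homo j k (suc n) = trans (con-suc (j *ᶻ k) n)
      (sym (trans (con-* j (con k) (suc n)) (trans (cong (j *ᶻ_) (con-suc k n)) (ℤ.*-zeroʳ j))))
    -‿homo : ∀ k n → con (-ᶻ k) n ≡ (- con k) n
    -‿homo k zero    = trans (con-zero (-ᶻ k)) (sym (trans (neg-at (con k) 0) (cong -ᶻ_ (con-zero k))))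
    -‿homo k (suc n) = trans (con-suc (-ᶻ k) n)
      (sym (trans (neg-at (con k) (suc n)) (cong -ᶻ_ (con-suc k n))))

  _≟_ : ∀ j k → Maybe (con j ≈ con k)
  j ≟ k with j ℤ.≟ k
  ... | yes refl = just ≈-refl
  ... | no _     = nothing

open import Algebra.Solver.Ring _ _ con-homomorphism _≟_
  using (solve; _:=_; _:+_; _:*_; _:-_; :-_) renaming (con to :con)
open import Relation.Binary.Reasoning.Setoid setoid
  using (begin_; step-≈-⟩; step-≈-⟨; _∎)

-- Lets the ring solver use a hypothesis x ≈ y: it suffices that l - r is a multiple of x - y.
by-multiple : ∀ p {x y l r} → x ≈ y → l + p * y ≈ r + p * x → l ≈ r
by-multiple p {x} {y} {l} {r} x≈y eq = begin
  l                      ≈⟨ solve 3 (λ l p y → l := l :+ p :* y :- p :* y) ≈-refl l p y ⟩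
  l + p * y - p * y      ≈⟨ +-cong eq (-‿cong (*-cong (≈-refl {p}) (≈-sym x≈y))) ⟩
  r + p * x - p * x      ≈⟨ solve 3 (λ r p x → r :+ p :* x :- p :* x := r) ≈-refl r p x ⟩
  r                      ∎

*-congˡ : ∀ {a b} c → a ≈ b → c * a ≈ c * b
*-congˡ c = *-cong ≈-refl

*-congʳ : ∀ {a b} c → a ≈ b → a * c ≈ b * c
*-congʳ c p = *-cong p ≈-refl

-- Monomials and inverses

opaque
  X : ℕ → Series
  X = q^_

opaque
  unfolding X

  X-q^ : ∀ j → X j ≡ q^ j
  X-q^ j = refl

  X-0 : X 0 ≈ 1#
  X-0 = pointwise λ { zero → sym (con-zero 1ℤ) ; (suc n) → sym (con-suc 1ℤ n) }

  X-suc-zero : ∀ j → X (suc j) 0 ≡ 0ℤ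
  X-suc-zero j = refl

  X-suc-suc : ∀ j n → X (suc j) (suc n) ≡ X j n
  X-suc-suc j n with suc n ℕ.≟ suc j | n ℕ.≟ j
  ... | yes _ | yes _ = refl
  ... | no _  | no _  = refl
  ... | yes p | no ¬p = contradiction (ℕ.suc-injective p) ¬p
  ... | no ¬p | yes p = contradiction (cong suc p) ¬p

X-suc-*-zero : ∀ j a → (X (suc j) * a) 0 ≡ 0ℤ
X-suc-*-zero j a = trans (*-zero (X (suc j)) a) (trans (cong (_*ᶻ a 0) (X-suc-zero j)) (ℤ.*-zeroˡ (a 0)))

X-suc-*-suc : ∀ j a n → (X (suc j) * a) (suc n) ≡ (X j * a) n
X-suc-*-suc j a n = trans (*-suc (X (suc j)) a n) (trans
  (cong₂ _+ᶻ_ (trans (cong (_*ᶻ a (suc n)) (X-suc-zero j)) (ℤ.*-zeroˡ (a (suc n))))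
     (at (*-congʳ a (pointwise {tail (X (suc j))} (X-suc-suc j))) n))
  (ℤ.+-identityˡ _))

X-1-*-suc : ∀ a n → (X 1 * a) (suc n) ≡ a n
X-1-*-suc a n = trans (X-suc-*-suc 0 a n) (at (≈-trans (*-congʳ a X-0) (*-identityˡ a)) n)

X-+ : ∀ i j → X (i ℕ.+ j) ≈ X i * X j
X-+ i j = pointwise (go i)
  where
  go : ∀ i n → X (i ℕ.+ j) n ≡ (X i * X j) n
  go zero    n       = at (≈-sym (≈-trans (*-congʳ (X j) X-0) (*-identityˡ (X j)))) n
  go (suc i) zero    = trans (X-suc-zero (i ℕ.+ j)) (sym (X-suc-*-zero i (X j)))
  go (suc i) (suc n) = trans (X-suc-suc (i ℕ.+ j) n) (trans (go i n) (sym (X-suc-*-suc i (X j) n)))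

X-cong : ∀ {i j} → i ≡ j → X i ≈ X j
X-cong refl = ≈-refl

inverse : Series → Series
inverse c = (q^ 0) ⊘ c

inverse-correct : ∀ c → c 0 ≡ 1ℤ → inverse c * c ≈ 1#
inverse-correct c c₀ = ≈-trans
  (pointwise λ n → trans (*-⊛ (inverse c) c n) (⊘-correct (q^ 0) c c₀ n))
  (subst (_≈ 1#) (X-q^ 0) X-0)

-- Congruence modulo q^K and q-adic limits

infix 4 _≈[_]_
record _≈[_]_ (a : Series) (K : ℕ) (b : Series) : Set where
  constructor pointwise<
  field at< : ∀ n → n ℕ.< K → a n ≡ b n
open _≈[_]_

module _ {K : ℕ} where
  ≈⇒≈[] : ∀ {a b} → a ≈ b → a ≈[ K ] b
  ≈⇒≈[] p = pointwise< λ n _ → at p n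

  ≈[]-refl : ∀ {a} → a ≈[ K ] a
  ≈[]-refl = ≈⇒≈[] ≈-refl

  ≈[]-sym : ∀ {a b} → a ≈[ K ] b → b ≈[ K ] a
  ≈[]-sym p = pointwise< λ n n<K → sym (at< p n n<K)

  ≈[]-trans : ∀ {a b c} → a ≈[ K ] b → b ≈[ K ] c → a ≈[ K ] c
  ≈[]-trans p r = pointwise< λ n n<K → trans (at< p n n<K) (at< r n n<K)

  +-cong[] : ∀ {a a′ b b′} → a ≈[ K ] a′ → b ≈[ K ] b′ → a + b ≈[ K ] a′ + b′
  +-cong[] {a} {a′} {b} {b′} p r = pointwise< λ n n<K →
    trans (+-at a b n) (trans (cong₂ _+ᶻ_ (at< p n n<K) (at< r n n<K)) (sym (+-at a′ b′ n)))

  neg-cong[] : ∀ {a a′} → a ≈[ K ] a′ → - a ≈[ K ] - a′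
  neg-cong[] {a} {a′} p = pointwise< λ n n<K →
    trans (neg-at a n) (trans (cong -ᶻ_ (at< p n n<K)) (sym (neg-at a′ n)))

  *-cong[] : ∀ {a a′ b b′} → a ≈[ K ] a′ → b ≈[ K ] b′ → a * b ≈[ K ] a′ * b′
  *-cong[] {a} {a′} {b} {b′} p r = pointwise< λ n n<K → trans (*-⊛ a b n) (trans
    (⊛-at-cong n (λ i i≤n → at< p i (ℕ.≤-<-trans i≤n n<K)) (λ i i≤n → at< r i (ℕ.≤-<-trans i≤n n<K)))
    (sym (*-⊛ a′ b′ n)))

X-vanishes : ∀ {K j} → K ℕ.≤ j → X j ≈[ K ] 0#
X-vanishes {K} {j} K≤j = pointwise< λ n n<K → go j n (ℕ.≤-trans n<K K≤j)
  where
  go : ∀ j n → n ℕ.< j → X j n ≡ 0# n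
  go (suc j) zero    _         = trans (X-suc-zero j) (sym (con-zero 0ℤ))
  go (suc j) (suc n) (s≤s n<j) = trans (X-suc-suc j n) (trans (go j n n<j)
    (trans (0#-at n) (sym (0#-at (suc n)))))
    where
    0#-at : ∀ n → 0# n ≡ 0ℤ
    0#-at zero    = con-zero 0ℤ
    0#-at (suc n) = con-suc 0ℤ n

X-*-vanishes : ∀ {K j} a → K ℕ.≤ j → X j * a ≈[ K ] 0#
X-*-vanishes a K≤j = ≈[]-trans (*-cong[] (X-vanishes K≤j) ≈[]-refl) (≈⇒≈[] (zeroˡ a))

module _ {K : ℕ} where
  private
    cancel-helper : ∀ {c d a} → d * c ≈ 1# → d * (c * a) ≈ a
    cancel-helper {c} {d} {a} p =
      ≈-trans (≈-sym (*-assoc d c a)) (≈-trans (*-congʳ a p) (*-identityˡ a))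

  *-cancelˡ[] : ∀ c {a b} → c 0 ≡ 1ℤ → c * a ≈[ K ] c * b → a ≈[ K ] b
  *-cancelˡ[] c {a} {b} c₀ p = ≈[]-trans (≈⇒≈[] (≈-sym (cancel-helper inv)))
    (≈[]-trans (*-cong[] ≈[]-refl p) (≈⇒≈[] (cancel-helper inv)))
    where inv = inverse-correct c c₀

≈[]⇒≈ : ∀ {a b} → (∀ K → a ≈[ K ] b) → a ≈ b
≈[]⇒≈ p = pointwise λ n → at< (p (suc n)) n ℕ.≤-refl

*-cancelˡ : ∀ c {a b} → c 0 ≡ 1ℤ → c * a ≈ c * b → a ≈ b
*-cancelˡ c c₀ p = ≈[]⇒≈ λ K → *-cancelˡ[] c c₀ (≈⇒≈[] p)

Tends : (ℕ → Series) → Series → Set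
Tends x a = ∀ K → ∃ λ N₀ → ∀ N → N₀ ℕ.≤ N → x N ≈[ K ] a

-- In the sequences of `tends-lim` the step from N to N + 1 leaves the coefficients below N alone,
-- so coefficient n is final from index n + 1 on.
lim : (ℕ → Series) → Series
lim x n = x (suc n) n

tends-lim : ∀ x → (∀ N → x (suc N) ≈[ N ] x N) → Tends x (lim x)
tends-lim x stable K = K , λ N K≤N → pointwise< λ n n<K →
  subst (λ M → x M n ≡ x (suc n) n) (ℕ.m∸n+n≡m (ℕ.≤-trans n<K K≤N)) (go n (N ℕ.∸ suc n))
  where
  go : ∀ n d → x (d ℕ.+ suc n) n ≡ x (suc n) n
  go n zero    = refl
  go n (suc d) = trans (at< (stable (d ℕ.+ suc n)) n (ℕ.m≤n+m (suc n) d)) (go n d)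

-- The passage from finite to infinite identities: an identity for each N between partial products
-- or partial sums is inherited by the limits.
tends-unique : ∀ {x y a b} → Tends x a → Tends y b → (∀ N → x N ≈ y N) → a ≈ b
tends-unique {x} {y} {a} {b} p r x≈y = ≈[]⇒≈ λ K →
  let N₁ , p′ = p K
      N₂ , r′ = r K
      N = N₁ ℕ.⊔ N₂
  in ≈[]-trans (≈[]-sym (p′ N (ℕ.m≤m⊔n N₁ N₂)))
       (≈[]-trans (≈⇒≈[] (x≈y N)) (r′ N (ℕ.m≤n⊔m N₁ N₂)))

private
  tends-∙ : (_∙_ : Series → Series → Series) →
            (∀ {K a a′ b b′} → a ≈[ K ] a′ → b ≈[ K ] b′ → (a ∙ b) ≈[ K ] (a′ ∙ b′)) →
            ∀ {x y a b} → Tends x a → Tends y b → Tends (λ N → x N ∙ y N) (a ∙ b)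
  tends-∙ _∙_ ∙-cong[] p r K =
    let N₁ , p′ = p K
        N₂ , r′ = r K
    in N₁ ℕ.⊔ N₂ , λ N N₀≤N → ∙-cong[] (p′ N (ℕ.≤-trans (ℕ.m≤m⊔n N₁ N₂) N₀≤N))
                                       (r′ N (ℕ.≤-trans (ℕ.m≤n⊔m N₁ N₂) N₀≤N))

tends-* : ∀ {x y a b} → Tends x a → Tends y b → Tends (λ N → x N * y N) (a * b)
tends-* = tends-∙ _*_ *-cong[]

tends-+ : ∀ {x y a b} → Tends x a → Tends y b → Tends (λ N → x N + y N) (a + b)
tends-+ = tends-∙ _+_ +-cong[]

tends-neg : ∀ {x a} → Tends x a → Tends (λ N → - x N) (- a)
tends-neg p K = let N₀ , p′ = p K in N₀ , λ N N₀≤N → neg-cong[] (p′ N N₀≤N)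

tends-constant : ∀ a → Tends (λ _ → a) a
tends-constant a K = 0 , λ _ _ → ≈[]-refl

tends-cong : ∀ {x y a} → (∀ N → x N ≈ y N) → Tends x a → Tends y a
tends-cong x≈y p K = let N₀ , p′ = p K in
  N₀ , λ N N₀≤N → ≈[]-trans (≈⇒≈[] (≈-sym (x≈y N))) (p′ N N₀≤N)

tends-subsequence : ∀ {x a} (σ : ℕ → ℕ) → (∀ N → N ℕ.≤ σ N) → Tends x a → Tends (λ N → x (σ N)) a
tends-subsequence σ N≤σN p K = let N₀ , p′ = p K in
  N₀ , λ N N₀≤N → p′ (σ N) (ℕ.≤-trans N₀≤N (N≤σN N))

tends-X-0 : ∀ (σ : ℕ → ℕ) → (∀ N → N ℕ.≤ σ N) → Tends (λ N → X (σ N)) 0#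
tends-X-0 σ N≤σN K = K , λ N K≤N → X-vanishes (ℕ.≤-trans K≤N (N≤σN N))

-- The Jacobi triple product

∏ : (ℕ → Series) → ℕ → Series
∏ u zero    = 1#
∏ u (suc N) = u N * ∏ u N

∏-zero : ∀ u → (∀ m → u m 0 ≡ 1ℤ) → ∀ N → ∏ u N 0 ≡ 1ℤ
∏-zero u u₀ zero    = con-zero 1ℤ
∏-zero u u₀ (suc N) = trans (*-zero (u N) (∏ u N)) (cong₂ _*ᶻ_ (u₀ N) (∏-zero u u₀ N))

tends-∏ : ∀ u → (∀ m → u m ≈[ m ] 1#) → Tends (∏ u) (lim (∏ u))
tends-∏ u u≈1 = tends-lim (∏ u) λ N →
  ≈[]-trans (*-cong[] (u≈1 N) ≈[]-refl) (≈⇒≈[] (*-identityˡ (∏ u N)))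

lim-∏-zero : ∀ u → (∀ m → u m 0 ≡ 1ℤ) → lim (∏ u) 0 ≡ 1ℤ
lim-∏-zero u u₀ = ∏-zero u u₀ 1

-- The sum over r + t = N. The summand receives both indices, which avoids truncated subtraction.
sumDiagonal : ℕ → (ℕ → ℕ → Series) → Series
sumDiagonal zero    g = g 0 0
sumDiagonal (suc N) g = g 0 (suc N) + sumDiagonal N (λ r t → g (suc r) t)

sumDiagonal-cong[] : ∀ {K} N {g h} → (∀ r t → r ℕ.+ t ≡ N → g r t ≈[ K ] h r t) →
                     sumDiagonal N g ≈[ K ] sumDiagonal N h
sumDiagonal-cong[] zero    p = p 0 0 refl
sumDiagonal-cong[] (suc N) p =
  +-cong[] (p 0 (suc N) refl) (sumDiagonal-cong[] N λ r t eq → p (suc r) t (cong suc eq))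

sumDiagonal-cong : ∀ N {g h} → (∀ r t → r ℕ.+ t ≡ N → g r t ≈ h r t) → sumDiagonal N g ≈ sumDiagonal N h
sumDiagonal-cong N p = ≈[]⇒≈ λ K → sumDiagonal-cong[] N λ r t eq → ≈⇒≈[] (p r t eq)

*-sumDiagonal : ∀ N c g → c * sumDiagonal N g ≈ sumDiagonal N (λ r t → c * g r t)
*-sumDiagonal zero    c g = ≈-refl
*-sumDiagonal (suc N) c g = ≈-trans
  (solve 3 (λ c x y → c :* (x :+ y) := c :* x :+ c :* y) ≈-refl c (g 0 (suc N)) _)
  (+-cong ≈-refl (*-sumDiagonal N c (λ r t → g (suc r) t)))

-- The series z absorbs the terms that the recursion along the diagonal carries over.
sumDiagonal-pascal : ∀ N (g v w : ℕ → ℕ → Series) (z : ℕ → Series) →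
  (∀ t → g 0 (suc t) ≈ z t + w 0 t) →
  (∀ r → g (suc r) 0 ≈ v r 0) →
  (∀ r t → g (suc r) (suc t) ≈ v r (suc t) + w (suc r) t) →
  sumDiagonal (suc N) g ≈ z N + sumDiagonal N (λ r t → w r t + v r t)
sumDiagonal-pascal zero    g v w z p₁ p₂ p₃ = ≈-trans (+-cong (p₁ 0) (p₂ 0))
  (solve 3 (λ z w v → z :+ w :+ v := z :+ (w :+ v)) ≈-refl (z 0) (w 0 0) (v 0 0))
sumDiagonal-pascal (suc N) g v w z p₁ p₂ p₃ = ≈-trans
  (+-cong (p₁ (suc N)) (sumDiagonal-pascal N (λ r → g (suc r)) (λ r → v (suc r)) (λ r → w (suc r))
    (λ t → v 0 (suc t)) (p₃ 0) (λ r → p₂ (suc r)) (λ r → p₃ (suc r))))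
  (solve 4 (λ z w v x → z :+ w :+ (v :+ x) := z :+ (w :+ v :+ x)) ≈-refl (z (suc N)) (w 0 (suc N)) (v 0 (suc N)) _)

sumDiagonal-last : ∀ N (u : ℕ → Series) →
  sumDiagonal (suc N) (λ r _ → u r) ≈ sumDiagonal N (λ r _ → u r) + u (suc N)
sumDiagonal-last zero    u = ≈-refl
sumDiagonal-last (suc N) u = ≈-trans (+-cong ≈-refl (sumDiagonal-last N (λ r → u (suc r))))
  (solve 3 (λ x y z → x :+ (y :+ z) := x :+ y :+ z) ≈-refl (u 0) _ (u (suc (suc N))))

factor⁻ factor⁺ : ℕ → ℕ → ℕ → Series
factor⁻ r s m = 1# - X (r ℕ.+ m ℕ.* s)
factor⁺ r s m = 1# + X (r ℕ.+ m ℕ.* s)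

1-X-zero : ∀ j → (1# - X (suc j)) 0 ≡ 1ℤ
1-X-zero j = trans (+-at 1# (- X (suc j)) 0)
  (cong₂ _+ᶻ_ (con-zero 1ℤ) (trans (neg-at (X (suc j)) 0) (cong -ᶻ_ (X-suc-zero j))))

-- With Q = q^s, the pair A, B with A B = Q stands for z and Q/z in the usual statement. Negative
-- powers of z become powers of B, and everything stays inside ℤ[[q]].
module JacobiTripleProduct (s-1 : ℕ) (A B : Series) (AB≈Q : A * B ≈ X (suc s-1)) where

  private
    s : ℕ
    s = suc s-1

    P : ℕ → Series
    P = ∏ (factor⁻ s s)

    P₀ : ∀ N → P N 0 ≡ 1ℤ
    P₀ = ∏-zero (factor⁻ s s) λ m → 1-X-zero (s-1 ℕ.+ m ℕ.* s)

    X-s-+ : ∀ i j → X ((i ℕ.+ j) ℕ.* s) ≈ X (i ℕ.* s) * X (j ℕ.* s)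
    X-s-+ i j = ≈-trans (X-cong (ℕ.*-distribʳ-+ s i j)) (X-+ (i ℕ.* s) (j ℕ.* s))

    -- The Gaussian binomial coefficient of r + t over r in the base Q. In this factorial form,
    -- symmetry and the Pascal rules follow by cancelling P r P t, which has constant term 1.
    gauss : ℕ → ℕ → Series
    gauss r t = P (r ℕ.+ t) * (inverse (P r) * inverse (P t))

    gauss-factorial : ∀ r t → P r * P t * gauss r t ≈ P (r ℕ.+ t)
    gauss-factorial r t = begin
      P r * P t * (P (r ℕ.+ t) * (inverse (P r) * inverse (P t)))
        ≈⟨ solve 5 (λ x y z x⁻¹ y⁻¹ → x :* y :* (z :* (x⁻¹ :* y⁻¹)) := z :* (x⁻¹ :* x) :* (y⁻¹ :* y))
             ≈-refl (P r) (P t) (P (r ℕ.+ t)) (inverse (P r)) (inverse (P t)) ⟩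
      P (r ℕ.+ t) * (inverse (P r) * P r) * (inverse (P t) * P t)
        ≈⟨ *-cong (*-congˡ (P (r ℕ.+ t)) (inverse-correct (P r) (P₀ r))) (inverse-correct (P t) (P₀ t)) ⟩
      P (r ℕ.+ t) * 1# * 1#
        ≈⟨ ≈-trans (*-identityʳ _) (*-identityʳ _) ⟩
      P (r ℕ.+ t)
        ∎

    gauss-unique : ∀ r t {x} → P r * P t * x ≈ P (r ℕ.+ t) → gauss r t ≈ x
    gauss-unique r t p = *-cancelˡ (P r * P t)
      (trans (*-zero (P r) (P t)) (cong₂ _*ᶻ_ (P₀ r) (P₀ t))) (≈-trans (gauss-factorial r t) (≈-sym p))

    P-cong : ∀ {i j} → i ≡ j → P i ≈ P j
    P-cong refl = ≈-refl

    gauss-zeroˡ : ∀ t → gauss 0 t ≈ 1#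
    gauss-zeroˡ t = gauss-unique 0 t (solve 1 (λ x → :con 1ℤ :* x :* :con 1ℤ := x) ≈-refl (P t))

    gauss-comm : ∀ r t → gauss r t ≈ gauss t r
    gauss-comm r t = gauss-unique r t (≈-trans (*-congʳ (gauss t r) (*-comm (P r) (P t)))
      (≈-trans (gauss-factorial t r) (P-cong (ℕ.+-comm t r))))

    gauss-zeroʳ : ∀ r → gauss r 0 ≈ 1#
    gauss-zeroʳ r = ≈-trans (gauss-comm r 0) (gauss-zeroˡ r)

    gauss-pascal : ∀ r t → gauss (suc r) (suc t) ≈ gauss (suc r) t + X (suc t ℕ.* s) * gauss r (suc t)
    gauss-pascal r t = gauss-unique (suc r) (suc t) (begin
      (1# - y) * P r * ((1# - x) * P t) * (gauss (suc r) t + x * gauss r (suc t))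
        ≈⟨ solve 6 (λ x y p p′ b b′ → let e = :con 1ℤ in
             (e :- y) :* p :* ((e :- x) :* p′) :* (b :+ x :* b′) :=
             (e :- x) :* ((e :- y) :* p :* p′ :* b) :+ x :* (e :- y) :* (p :* ((e :- x) :* p′) :* b′))
             ≈-refl x y (P r) (P t) (gauss (suc r) t) (gauss r (suc t)) ⟩
      (1# - x) * (P (suc r) * P t * gauss (suc r) t) + x * (1# - y) * (P r * P (suc t) * gauss r (suc t))
        ≈⟨ +-cong (*-congˡ (1# - x) (≈-trans (gauss-factorial (suc r) t) (P-cong (sym (ℕ.+-suc r t)))))
             (*-congˡ (x * (1# - y)) (gauss-factorial r (suc t))) ⟩
      (1# - x) * Z + x * (1# - y) * Z
        ≈⟨ solve 3 (λ x y z → let e = :con 1ℤ in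
             (e :- x) :* z :+ x :* (e :- y) :* z := (e :- y :* x) :* z) ≈-refl x y Z ⟩
      (1# - y * x) * Z
        ≈⟨ *-congʳ Z (+-cong ≈-refl (-‿cong (X-s-+ (suc r) (suc t)))) ⟨
      P (suc r ℕ.+ suc t)
        ∎)
      where
      x = X (suc t ℕ.* s)
      y = X (suc r ℕ.* s)
      Z = P (r ℕ.+ suc t)

    gauss-pascal′ : ∀ r t → gauss (suc r) (suc t) ≈ gauss r (suc t) + X (suc r ℕ.* s) * gauss (suc r) t
    gauss-pascal′ r t = ≈-trans (gauss-comm (suc r) (suc t)) (≈-trans (gauss-pascal t r)
      (+-cong (gauss-comm (suc t) r) (*-congˡ (X (suc r ℕ.* s)) (gauss-comm t (suc r)))))

  -- term C n = Cⁿ Q^{n(n-1)/2}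
  term : Series → ℕ → Series
  term C zero    = 1#
  term C (suc n) = term C n * (C * X (n ℕ.* s))

  θ : ℕ → Series
  θ zero    = 1#
  θ (suc N) = θ N + (term A (suc N) + term B (suc N))

  private
    -- The two-sided sequence …, term B 1, 1, term A 1, … with its centre at index j.
    ε : ℕ → ℕ → Series
    ε zero    r       = term A r
    ε (suc j) zero    = term B (suc j)
    ε (suc j) (suc r) = ε j r

    ε-zero : ∀ j → ε j 0 ≡ term B j
    ε-zero zero    = refl
    ε-zero (suc j) = refl

    ε-below : ∀ r n → ε (r ℕ.+ n) r ≡ term B n
    ε-below zero    n = ε-zero n
    ε-below (suc r) n = ε-below r n

    ε-above : ∀ j n → ε j (j ℕ.+ n) ≡ term A n
    ε-above zero    n = refl
    ε-above (suc j) n = ε-above j n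

    -- Consecutive entries of the two-sided sequence have ratio A Q^(r-j), and i = t + (r - j) on
    -- the diagonal. Left of the centre the negative power of Q is absorbed by A B = Q.
    A-shift : ∀ j r t i → r ℕ.+ t ≡ i ℕ.+ j → A * X (i ℕ.* s) * ε j r ≈ X (t ℕ.* s) * ε j (suc r)
    A-shift zero r t i eq = ≈-trans
      (*-congʳ (term A r) (*-congˡ A (≈-trans (X-cong (cong (ℕ._* s) (trans (sym (ℕ.+-identityʳ i)) (sym eq)))) (X-s-+ r t))))
      (solve 4 (λ a x y e → a :* (x :* y) :* e := y :* (e :* (a :* x))) ≈-refl
        A (X (r ℕ.* s)) (X (t ℕ.* s)) (term A r))
    A-shift (suc j) zero t i eq = begin
      A * X (i ℕ.* s) * (term B j * (B * X (j ℕ.* s)))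
        ≈⟨ solve 5 (λ a x e b y → a :* x :* (e :* (b :* y)) := a :* b :* (x :* y) :* e) ≈-refl
             A (X (i ℕ.* s)) (term B j) B (X (j ℕ.* s)) ⟩
      A * B * (X (i ℕ.* s) * X (j ℕ.* s)) * term B j
        ≈⟨ *-cong (*-cong AB≈Q (≈-sym (X-s-+ i j))) ≈-refl ⟩
      X s * X ((i ℕ.+ j) ℕ.* s) * term B j
        ≈⟨ *-cong (≈-trans (≈-sym (X-+ s ((i ℕ.+ j) ℕ.* s)))
             (X-cong (cong (ℕ._* s) (trans (sym (ℕ.+-suc i j)) (sym eq)))))
             (≈-reflexive (sym (ε-zero j))) ⟩
      X (t ℕ.* s) * ε j 0
        ∎
    A-shift (suc j) (suc r) t i eq = A-shift j r t i (ℕ.suc-injective (trans eq (ℕ.+-suc i j)))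

    -- Moving the centre up by one place multiplies the entry at r by B Q^(j-r); the factor Q^r
    -- clears the possibly negative exponent.
    B-shift : ∀ j r → B * X (j ℕ.* s) * ε j r ≈ X (r ℕ.* s) * ε (suc j) r
    B-shift j zero = subst (λ e → B * X (j ℕ.* s) * e ≈ X 0 * term B (suc j)) (sym (ε-zero j))
      (≈-trans (solve 3 (λ b x e → b :* x :* e := :con 1ℤ :* (e :* (b :* x))) ≈-refl B (X (j ℕ.* s)) (term B j))
        (*-congʳ (term B (suc j)) (≈-sym X-0)))
    B-shift zero (suc r) = begin
      B * X 0 * (term A r * (A * X (r ℕ.* s)))
        ≈⟨ *-congʳ (term A (suc r)) (*-congˡ B X-0) ⟩
      B * 1# * (term A r * (A * X (r ℕ.* s)))
        ≈⟨ solve 4 (λ b e a x → b :* :con 1ℤ :* (e :* (a :* x)) := a :* b :* x :* e) ≈-refl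
             B (term A r) A (X (r ℕ.* s)) ⟩
      A * B * X (r ℕ.* s) * term A r
        ≈⟨ *-congʳ (term A r) (≈-trans (*-congʳ (X (r ℕ.* s)) AB≈Q) (≈-sym (X-+ s (r ℕ.* s)))) ⟩
      X (suc r ℕ.* s) * term A r
        ∎
    B-shift (suc j) (suc r) = begin
      B * X (suc j ℕ.* s) * ε j r
        ≈⟨ *-congʳ (ε j r) (*-congˡ B (X-+ s (j ℕ.* s))) ⟩
      B * (X s * X (j ℕ.* s)) * ε j r
        ≈⟨ solve 4 (λ b q x e → b :* (q :* x) :* e := q :* (b :* x :* e)) ≈-refl B (X s) (X (j ℕ.* s)) (ε j r) ⟩
      X s * (B * X (j ℕ.* s) * ε j r)
        ≈⟨ *-congˡ (X s) (B-shift j r) ⟩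
      X s * (X (r ℕ.* s) * ε (suc j) r)
        ≈⟨ *-assoc (X s) (X (r ℕ.* s)) (ε (suc j) r) ⟨
      X s * X (r ℕ.* s) * ε (suc j) r
        ≈⟨ *-congʳ (ε (suc j) r) (X-+ s (r ℕ.* s)) ⟨
      X (suc r ℕ.* s) * ε (suc j) r
        ∎

  factor : Series → ℕ → Series
  factor C m = 1# + C * X (m ℕ.* s)

  private
    expansion : ℕ → ℕ → Series
    expansion N j = sumDiagonal N (λ r t → gauss r t * ε j r)

    0+ : ∀ x → x ≈ 0# + x
    0+ x = ≈-sym (+-identityˡ x)

    A-step : ∀ i j → factor A i * expansion (i ℕ.+ j) j ≈ expansion (suc i ℕ.+ j) j
    A-step i j = begin
      factor A i * expansion (i ℕ.+ j) j
        ≈⟨ *-sumDiagonal (i ℕ.+ j) (factor A i) (λ r t → gauss r t * ε j r) ⟩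
      sumDiagonal (i ℕ.+ j) (λ r t → factor A i * (gauss r t * ε j r))
        ≈⟨ sumDiagonal-cong (i ℕ.+ j) (λ r t eq →
             by-multiple (gauss r t) (A-shift j r t i eq)
               (solve 4 (λ b e k l → (:con 1ℤ :+ k) :* (b :* e) :+ b :* l :=
                           b :* e :+ b :* l :+ b :* (k :* e)) ≈-refl
                 (gauss r t) (ε j r) (A * X (i ℕ.* s)) (X (t ℕ.* s) * ε j (suc r)))) ⟩
      sumDiagonal (i ℕ.+ j) (λ r t → gauss r t * ε j r + gauss r t * (X (t ℕ.* s) * ε j (suc r)))
        ≈⟨ +-identityˡ _ ⟨
      0# + sumDiagonal (i ℕ.+ j) (λ r t → gauss r t * ε j r + gauss r t * (X (t ℕ.* s) * ε j (suc r)))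
        ≈⟨ sumDiagonal-pascal (i ℕ.+ j) (λ r t → gauss r t * ε j r) _ _ (λ _ → 0#)
             (λ t → ≈-trans (*-congʳ (ε j 0) (≈-trans (gauss-zeroˡ (suc t)) (≈-sym (gauss-zeroˡ t)))) (0+ _))
             (λ r → ≈-trans (*-congʳ (ε j (suc r)) (≈-trans (gauss-zeroʳ (suc r)) (≈-sym (gauss-zeroʳ r))))
                (*-congˡ (gauss r 0) (≈-sym (≈-trans (*-congʳ _ X-0) (*-identityˡ _)))))
             (λ r t → ≈-trans (*-congʳ (ε j (suc r)) (gauss-pascal r t))
                (solve 4 (λ b x b′ e → (b :+ x :* b′) :* e := b′ :* (x :* e) :+ b :* e) ≈-refl
                  (gauss (suc r) t) (X (suc t ℕ.* s)) (gauss r (suc t)) (ε j (suc r)))) ⟨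
      expansion (suc i ℕ.+ j) j
        ∎

    B-step : ∀ j → factor B j * expansion j j ≈ expansion (suc j) (suc j)
    B-step j = begin
      factor B j * expansion j j
        ≈⟨ *-sumDiagonal j (factor B j) (λ r t → gauss r t * ε j r) ⟩
      sumDiagonal j (λ r t → factor B j * (gauss r t * ε j r))
        ≈⟨ sumDiagonal-cong j (λ r t _ →
             by-multiple (gauss r t) (B-shift j r)
               (solve 4 (λ b e k l → (:con 1ℤ :+ k) :* (b :* e) :+ b :* l :=
                           b :* l :+ b :* e :+ b :* (k :* e)) ≈-refl
                 (gauss r t) (ε j r) (B * X (j ℕ.* s)) (X (r ℕ.* s) * ε (suc j) r))) ⟩
      sumDiagonal j (λ r t → gauss r t * (X (r ℕ.* s) * ε (suc j) r) + gauss r t * ε j r)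
        ≈⟨ +-identityˡ _ ⟨
      0# + sumDiagonal j (λ r t → gauss r t * (X (r ℕ.* s) * ε (suc j) r) + gauss r t * ε j r)
        ≈⟨ sumDiagonal-pascal j (λ r t → gauss r t * ε (suc j) r) _ _ (λ _ → 0#)
             (λ t → ≈-trans (*-cong (≈-trans (gauss-zeroˡ (suc t)) (≈-sym (gauss-zeroˡ t)))
                (≈-sym (≈-trans (*-congʳ _ X-0) (*-identityˡ _)))) (0+ _))
             (λ r → *-congʳ (ε j r) (≈-trans (gauss-zeroʳ (suc r)) (≈-sym (gauss-zeroʳ r))))
             (λ r t → ≈-trans (*-congʳ (ε j r) (gauss-pascal′ r t))
                (solve 4 (λ b x b′ e → (b :+ x :* b′) :* e := b :* e :+ b′ :* (x :* e)) ≈-refl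
                  (gauss r (suc t)) (X (suc r ℕ.* s)) (gauss (suc r) t) (ε j r))) ⟨
      expansion (suc j) (suc j)
        ∎

    -- The finite form of the triple product, a two-sided q-binomial theorem. A new A-factor only
    -- lengthens the diagonal and uses one Pascal rule; a new B-factor also moves the centre and
    -- uses the other.
    finite-product : ∀ i j → ∏ (factor A) i * ∏ (factor B) j ≈ expansion (i ℕ.+ j) j
    finite-product zero zero = *-congʳ 1# (≈-sym (gauss-zeroˡ 0))
    finite-product zero (suc j) = ≈-trans
      (solve 2 (λ x y → :con 1ℤ :* (x :* y) := x :* (:con 1ℤ :* y)) ≈-refl (factor B j) (∏ (factor B) j))
      (≈-trans (*-congˡ (factor B j) (finite-product zero j)) (B-step j))
    finite-product (suc i) j = ≈-trans (*-assoc (factor A i) (∏ (factor A) i) (∏ (factor B) j))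
      (≈-trans (*-congˡ (factor A i) (finite-product i j)) (A-step i j))

    half : Series → ℕ → Series
    half C zero    = 0#
    half C (suc n) = half C n + term C (suc n)

    ε-sum : ∀ i j → sumDiagonal (j ℕ.+ i) (λ r _ → ε j r) ≈ 1# + half A i + half B j
    ε-sum zero    zero    = ≈-sym (≈-trans (+-identityʳ _) (+-identityʳ _))
    ε-sum (suc i) zero    = ≈-trans (sumDiagonal-last i (term A)) (≈-trans (+-cong (ε-sum i zero) ≈-refl)
      (solve 3 (λ h t z → :con 1ℤ :+ h :+ z :+ t := :con 1ℤ :+ (h :+ t) :+ z) ≈-refl (half A i) (term A (suc i)) 0#))
    ε-sum i       (suc j) = ≈-trans (+-cong ≈-refl (ε-sum i j))
      (solve 3 (λ t h h′ → t :+ (:con 1ℤ :+ h :+ h′) := :con 1ℤ :+ h :+ (h′ :+ t)) ≈-refl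
        (term B (suc j)) (half A i) (half B j))

    θ-halves : ∀ N → θ N ≈ 1# + half A N + half B N
    θ-halves zero    = ≈-sym (≈-trans (+-identityʳ _) (+-identityʳ _))
    θ-halves (suc N) = ≈-trans (+-cong (θ-halves N) ≈-refl)
      (solve 4 (λ h h′ t t′ → :con 1ℤ :+ h :+ h′ :+ (t :+ t′) := :con 1ℤ :+ (h :+ t) :+ (h′ :+ t′)) ≈-refl
        (half A N) (half B N) (term A (suc N)) (term B (suc N)))

    term-vanishes : ∀ {K n} C → K ℕ.< n → term C n ≈[ K ] 0#
    term-vanishes {K} {suc n} C (s≤s K≤n) = ≈[]-trans
      (≈⇒≈[] (solve 3 (λ t c x → t :* (c :* x) := x :* (t :* c)) ≈-refl (term C n) C (X (n ℕ.* s))))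
      (X-*-vanishes (term C n * C) (ℕ.≤-trans K≤n (ℕ.m≤m*n n s)))

  -- In the finite product with i = j = N the Gaussian binomials tend to 1/c near the centre, and
  -- far from the centre the theta terms are already 0 modulo q^K. So c times the finite product
  -- agrees with the plain partial sum θ.
  tends-θ : ∀ {a b c} → Tends (∏ (factor A)) a → Tends (∏ (factor B)) b → Tends P c → c 0 ≡ 1ℤ →
            Tends θ (c * (a * b))
  tends-θ {a} {b} {c} A→a B→b P→c c₀ K =
    let N₁ , AB→ab = tends-* A→a B→b K
        N₂ , P→c′ = P→c K
    in N₁ ℕ.+ (K ℕ.+ suc N₂) , λ N N₀≤N →
       ≈[]-trans (θ≈cE N N₂ P→c′ (ℕ.≤-trans (ℕ.m≤n+m (K ℕ.+ suc N₂) N₁) N₀≤N))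
         (*-cong[] (≈[]-refl {a = c}) (≈[]-trans (≈⇒≈[] (≈-sym (finite-product N N)))
           (AB→ab N (ℕ.≤-trans (ℕ.m≤m+n N₁ _) N₀≤N))))
    where
    module _ (N N₂ : ℕ) (P→c′ : ∀ n → N₂ ℕ.≤ n → P n ≈[ K ] c) (N-large : K ℕ.+ suc N₂ ℕ.≤ N) where

      -- `gauss r t` is P(r+t) / (P r P t), hence close to c/(c c) once both indices are large.
      c*gauss : ∀ r t → N₂ ℕ.≤ r → N₂ ℕ.≤ t → c * gauss r t ≈[ K ] 1#
      c*gauss r t N₂≤r N₂≤t = *-cancelˡ[] c c₀ (≈[]-trans
        (≈⇒≈[] (≈-sym (*-assoc c c (gauss r t))))
        (≈[]-trans (*-cong[] (*-cong[] (≈[]-sym (P→c′ r N₂≤r)) (≈[]-sym (P→c′ t N₂≤t))) ≈[]-refl)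
        (≈[]-trans (≈⇒≈[] (gauss-factorial r t))
        (≈[]-trans (P→c′ (r ℕ.+ t) (ℕ.≤-trans N₂≤r (ℕ.m≤m+n r t)))
        (≈⇒≈[] (≈-sym (*-identityʳ c)))))))

      large-gap : ∀ {m n} → n ℕ.< N₂ → n ℕ.+ m ≡ N → K ℕ.< m
      large-gap {m} {n} n<N₂ eq = ℕ.+-cancelˡ-≤ n (suc K) m
        (ℕ.≤-trans (ℕ.≤-reflexive (ℕ.+-comm n (suc K)))
        (ℕ.≤-trans (ℕ.+-monoʳ-≤ (suc K) (ℕ.<⇒≤ n<N₂))
        (ℕ.≤-trans (ℕ.≤-reflexive (sym (ℕ.+-suc K N₂)))
        (ℕ.≤-trans N-large (ℕ.≤-reflexive (sym eq))))))

      N₂≤N : N₂ ℕ.≤ N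
      N₂≤N = ℕ.≤-trans (ℕ.n≤1+n N₂) (ℕ.≤-trans (ℕ.m≤n+m (suc N₂) K) N-large)

      both-vanish : ∀ {x e} → e ≈[ K ] 0# → x * e ≈[ K ] e
      both-vanish {x} e≈0 = ≈[]-trans (*-cong[] ≈[]-refl e≈0) (≈[]-trans (≈⇒≈[] (zeroʳ x)) (≈[]-sym e≈0))

      -- If r or t is below N₂, then position r lies more than K places from the centre N, and the
      -- high power of Q in `ε N r` kills the term whatever its binomial is. Otherwise `c*gauss`
      -- applies.
      coefficient : ∀ r t → r ℕ.+ t ≡ N ℕ.+ N → c * gauss r t * ε N r ≈[ K ] ε N r
      coefficient r t eq with N₂ ℕ.≤? r | N₂ ℕ.≤? t
      ... | yes N₂≤r | yes N₂≤t = ≈[]-trans (*-cong[] (c*gauss r t N₂≤r N₂≤t) ≈[]-refl) (≈⇒≈[] (*-identityˡ _))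
      ... | no ¬N₂≤r | _ = both-vanish (subst (_≈[ K ] 0#)
              (sym (subst (λ j → ε j r ≡ term B (N ℕ.∸ r)) r+ (ε-below r (N ℕ.∸ r))))
              (term-vanishes B (large-gap (ℕ.≰⇒> ¬N₂≤r) r+)))
        where
        r+ : r ℕ.+ (N ℕ.∸ r) ≡ N
        r+ = ℕ.m+[n∸m]≡n (ℕ.≤-trans (ℕ.<⇒≤ (ℕ.≰⇒> ¬N₂≤r)) N₂≤N)
      ... | yes _ | no ¬N₂≤t = both-vanish (subst (_≈[ K ] 0#)
              (sym (subst (λ r → ε N r ≡ term A (N ℕ.∸ t)) r≡ (ε-above N (N ℕ.∸ t))))
              (term-vanishes A (large-gap (ℕ.≰⇒> ¬N₂≤t) t+)))
        where
        t+ : t ℕ.+ (N ℕ.∸ t) ≡ N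
        t+ = ℕ.m+[n∸m]≡n (ℕ.≤-trans (ℕ.<⇒≤ (ℕ.≰⇒> ¬N₂≤t)) N₂≤N)
        r≡ : N ℕ.+ (N ℕ.∸ t) ≡ r
        r≡ = ℕ.+-cancelʳ-≡ t (N ℕ.+ (N ℕ.∸ t)) r (trans (ℕ.+-assoc N _ t)
          (trans (cong (N ℕ.+_) (trans (ℕ.+-comm (N ℕ.∸ t) t) t+)) (sym eq)))

      θ≈cE : θ N ≈[ K ] c * expansion (N ℕ.+ N) N
      θ≈cE = ≈[]-trans (≈⇒≈[] (≈-trans (θ-halves N) (≈-sym (ε-sum N N))))
        (≈[]-trans (sumDiagonal-cong[] (N ℕ.+ N) (λ r t eq → ≈[]-trans (≈[]-sym (coefficient r t eq))
          (≈⇒≈[] (*-assoc c (gauss r t) (ε N r)))))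
        (≈⇒≈[] (≈-sym (*-sumDiagonal (N ℕ.+ N) c (λ r t → gauss r t * ε N r)))))

-- Dissection modulo 3

opaque
  -- The part of a whose exponents are r modulo 3, with q^{3n+r} replaced by qⁿ.
  U : ℕ → Series → Series
  U r a n = a (r ℕ.+ n ℕ.* 3)

  -- V a is a(q³).
  V : Series → Series
  V a zero                = a 0
  V a (suc zero)          = 0ℤ
  V a (suc (suc zero))    = 0ℤ
  V a (suc (suc (suc n))) = V (tail a) n

opaque
  unfolding U

  U-at : ∀ r a n → U r a n ≡ a (r ℕ.+ n ℕ.* 3)
  U-at r a n = refl

  U-cong : ∀ r {a b} → a ≈ b → U r a ≈ U r b
  U-cong r p = pointwise λ n → at p (r ℕ.+ n ℕ.* 3)

  U-cong[] : ∀ {K} r {a b} → a ≈[ r ℕ.+ K ℕ.* 3 ] b → U r a ≈[ K ] U r b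
  U-cong[] r p = pointwise< λ n n<K → at< p (r ℕ.+ n ℕ.* 3) (ℕ.+-monoʳ-< r (ℕ.*-monoˡ-< 3 n<K))

  V-cong[] : ∀ {K a b} → a ≈[ K ] b → V a ≈[ K ] V b
  V-cong[] {K} p = pointwise< λ n → go n K p
    where
    go : ∀ n K {a b} → a ≈[ K ] b → n ℕ.< K → V a n ≡ V b n
    go zero                K       p n<K       = at< p 0 n<K
    go (suc zero)          K       p n<K       = refl
    go (suc (suc zero))    K       p n<K       = refl
    go (suc (suc (suc n))) (suc K) p (s≤s n<K) =
      go n K (pointwise< λ m m<K → at< p (suc m) (s≤s m<K)) (ℕ.≤-trans (ℕ.m≤n+m (suc n) 2) n<K)

  private
    V-0+ : ∀ a n → V a (n ℕ.* 3) ≡ a n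
    V-0+ a zero    = refl
    V-0+ a (suc n) = V-0+ (tail a) n

    V-1+ : ∀ a n → V a (1 ℕ.+ n ℕ.* 3) ≡ 0ℤ
    V-1+ a zero    = refl
    V-1+ a (suc n) = V-1+ (tail a) n

    V-2+ : ∀ a n → V a (2 ℕ.+ n ℕ.* 3) ≡ 0ℤ
    V-2+ a zero    = refl
    V-2+ a (suc n) = V-2+ (tail a) n

    0#-at : ∀ n → 0# n ≡ 0ℤ
    0#-at zero    = con-zero 0ℤ
    0#-at (suc n) = con-suc 0ℤ n

  U₀-V : ∀ a → U 0 (V a) ≈ a
  U₀-V a = pointwise (V-0+ a)

  U₁-V : ∀ a → U 1 (V a) ≈ 0#
  U₁-V a = pointwise λ n → trans (V-1+ a n) (sym (0#-at n))

  U₂-V : ∀ a → U 2 (V a) ≈ 0#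
  U₂-V a = pointwise λ n → trans (V-2+ a n) (sym (0#-at n))

  U-+ : ∀ r a b → U r (a + b) ≈ U r a + U r b
  U-+ r a b = pointwise λ n → trans (+-at a b _) (sym (+-at (U r a) (U r b) n))

  U-neg : ∀ r a → U r (- a) ≈ - U r a
  U-neg r a = pointwise λ n → trans (neg-at a _) (sym (neg-at (U r a) n))

  private
    V-*-suc : ∀ a b n → (V a * b) (suc (suc (suc n))) ≡ a 0 *ᶻ b (suc (suc (suc n))) +ᶻ (V (tail a) * b) n
    V-*-suc a b n = trans (*-suc (V a) b (suc (suc n))) (cong (a 0 *ᶻ b (suc (suc (suc n))) +ᶻ_)
      (trans (skip (tail (V a)) (suc n) refl) (skip (tail (tail (V a))) n refl)))
      where
      skip : ∀ c m → c 0 ≡ 0ℤ → (c * b) (suc m) ≡ (tail c * b) m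
      skip c m c₀ = trans (*-suc c b m)
        (trans (cong (_+ᶻ (tail c * b) m) (trans (cong (_*ᶻ b (suc m)) c₀) (ℤ.*-zeroˡ (b (suc m)))))
          (ℤ.+-identityˡ ((tail c * b) m)))

    step : ∀ a b n {w} → (V (tail a) * b) n ≡ w → (V a * b) (suc (suc (suc n))) ≡ a 0 *ᶻ b (suc (suc (suc n))) +ᶻ w
    step a b n p = trans (V-*-suc a b n) (cong (a 0 *ᶻ b (suc (suc (suc n))) +ᶻ_) p)

  -- Multiplying by a series in q³ preserves residue classes of exponents, so `U` is linear over
  -- ℤ[[q³]]. This, with its two companions, is how factors are pulled out of `U` throughout.
  U₀-V-* : ∀ a b → U 0 (V a * b) ≈ a * U 0 b
  U₀-V-* a b = pointwise (go a)
    where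
    go : ∀ a n → (V a * b) (n ℕ.* 3) ≡ (a * U 0 b) n
    go a zero    = trans (*-zero (V a) b) (sym (*-zero a (U 0 b)))
    go a (suc n) = trans (step a b (n ℕ.* 3) (go (tail a) n)) (sym (*-suc a (U 0 b) n))

  U₁-V-* : ∀ a b → U 1 (V a * b) ≈ a * U 1 b
  U₁-V-* a b = pointwise (go a)
    where
    go : ∀ a n → (V a * b) (1 ℕ.+ n ℕ.* 3) ≡ (a * U 1 b) n
    go a zero    = trans (*-suc (V a) b 0) (trans
      (cong (a 0 *ᶻ b 1 +ᶻ_) (trans (*-zero (tail (V a)) b) (ℤ.*-zeroˡ (b 0))))
      (trans (ℤ.+-identityʳ (a 0 *ᶻ b 1)) (sym (*-zero a (U 1 b)))))
    go a (suc n) = trans (step a b (1 ℕ.+ n ℕ.* 3) (go (tail a) n)) (sym (*-suc a (U 1 b) n))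

  U₂-V-* : ∀ a b → U 2 (V a * b) ≈ a * U 2 b
  U₂-V-* a b = pointwise (go a)
    where
    go : ∀ a n → (V a * b) (2 ℕ.+ n ℕ.* 3) ≡ (a * U 2 b) n
    go a zero    = trans (*-suc (V a) b 1) (trans
      (cong (a 0 *ᶻ b 2 +ᶻ_) (trans (*-suc (tail (V a)) b 0)
        (cong₂ _+ᶻ_ (ℤ.*-zeroˡ (b 1)) (trans (*-zero (tail (tail (V a))) b) (ℤ.*-zeroˡ (b 0))))))
      (trans (ℤ.+-identityʳ (a 0 *ᶻ b 2)) (sym (*-zero a (U 2 b)))))
    go a (suc n) = trans (step a b (2 ℕ.+ n ℕ.* 3) (go (tail a) n)) (sym (*-suc a (U 2 b) n))

  U₀-X : ∀ a → U 0 (X 1 * a) ≈ X 1 * U 2 a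
  U₀-X a = pointwise λ
    { zero    → trans (X-suc-*-zero 0 a) (sym (X-suc-*-zero 0 (U 2 a)))
    ; (suc n) → trans (X-1-*-suc a (2 ℕ.+ n ℕ.* 3)) (sym (X-1-*-suc (U 2 a) n)) }

  U₁-X : ∀ a → U 1 (X 1 * a) ≈ U 0 a
  U₁-X a = pointwise λ n → X-1-*-suc a (n ℕ.* 3)

  U₂-X : ∀ a → U 2 (X 1 * a) ≈ U 1 a
  U₂-X a = pointwise λ n → X-1-*-suc a (1 ℕ.+ n ℕ.* 3)

  U-injective : ∀ {a b} → U 0 a ≈ U 0 b → U 1 a ≈ U 1 b → U 2 a ≈ U 2 b → a ≈ b
  U-injective {a} {b} p₀ p₁ p₂ = pointwise (go a b (at p₀) (at p₁) (at p₂))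
    where
    go : ∀ (a b : Series) → (∀ n → a (n ℕ.* 3) ≡ b (n ℕ.* 3)) → (∀ n → a (1 ℕ.+ n ℕ.* 3) ≡ b (1 ℕ.+ n ℕ.* 3)) →
         (∀ n → a (2 ℕ.+ n ℕ.* 3) ≡ b (2 ℕ.+ n ℕ.* 3)) → ∀ n → a n ≡ b n
    go a b p₀ p₁ p₂ zero    = p₀ 0
    -- Dropping the constant coefficient rotates the three residue classes; class 0 returns as class
    -- 2 with its index raised by one.
    go a b p₀ p₁ p₂ (suc n) = go (tail a) (tail b) p₁ p₂ (λ m → p₀ (suc m)) n

  V-con : ∀ k → V (con k) ≈ con k
  V-con k = U-injective
    (pointwise λ
      { zero    → refl
      ; (suc n) → trans (V-0+ (con k) (suc n)) (trans (con-suc k n) (sym (con-suc k _))) })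
    (pointwise λ n → trans (V-1+ (con k) n) (sym (con-suc k _)))
    (pointwise λ n → trans (V-2+ (con k) n) (sym (con-suc k _)))

  V-X : ∀ j → V (X j) ≈ X (j ℕ.* 3)
  V-X j = pointwise (go j)
    where
    V-at-cong : ∀ n {a b} → (∀ m → a m ≡ b m) → V a n ≡ V b n
    V-at-cong n p = at< (V-cong[] {suc n} (pointwise< λ m _ → p m)) n ℕ.≤-refl
    V-0 : ∀ n → V (λ _ → 0ℤ) n ≡ 0ℤ
    V-0 zero                = refl
    V-0 (suc zero)          = refl
    V-0 (suc (suc zero))    = refl
    V-0 (suc (suc (suc n))) = V-0 n
    go : ∀ j n → V (X j) n ≡ X (j ℕ.* 3) n
    go zero    zero    = refl
    go zero    (suc zero)    = sym (trans (at X-0 1) (con-suc 1ℤ 0))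
    go zero    (suc (suc zero))    = sym (trans (at X-0 2) (con-suc 1ℤ 1))
    go zero    (suc (suc (suc n))) = trans (V-at-cong n λ m → trans (at X-0 (suc m)) (con-suc 1ℤ m))
      (trans (V-0 n) (sym (trans (at X-0 (3 ℕ.+ n)) (con-suc 1ℤ (2 ℕ.+ n)))))
    go (suc j) zero    = trans (X-suc-zero j) (sym (X-suc-zero (2 ℕ.+ j ℕ.* 3)))
    go (suc j) (suc zero)    = sym (trans (X-suc-suc (2 ℕ.+ j ℕ.* 3) 0) (X-suc-zero (1 ℕ.+ j ℕ.* 3)))
    go (suc j) (suc (suc zero)) = sym (trans (X-suc-suc (2 ℕ.+ j ℕ.* 3) 1)
      (trans (X-suc-suc (1 ℕ.+ j ℕ.* 3) 0) (X-suc-zero (j ℕ.* 3))))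
    go (suc j) (suc (suc (suc n))) = trans (V-at-cong n (X-suc-suc j)) (trans (go j n)
      (sym (trans (X-suc-suc (2 ℕ.+ j ℕ.* 3) (2 ℕ.+ n))
        (trans (X-suc-suc (1 ℕ.+ j ℕ.* 3) (1 ℕ.+ n)) (X-suc-suc (j ℕ.* 3) n)))))

V-cong : ∀ {a b} → a ≈ b → V a ≈ V b
V-cong p = ≈[]⇒≈ λ K → V-cong[] (≈⇒≈[] p)

tends-V : ∀ {x a} → Tends x a → Tends (λ N → V (x N)) (V a)
tends-V p K = let N₀ , p′ = p K in N₀ , λ N N₀≤N → V-cong[] (p′ N N₀≤N)

tends-U : ∀ r {x a} → Tends x a → Tends (λ N → U r (x N)) (U r a)
tends-U r p K = let N₀ , p′ = p (r ℕ.+ K ℕ.* 3) in N₀ , λ N N₀≤N → U-cong[] r (p′ N N₀≤N)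

V-+ : ∀ a b → V (a + b) ≈ V a + V b
V-+ a b = U-injective
  (≈-trans (U₀-V _) (≈-sym (≈-trans (U-+ 0 (V a) (V b)) (+-cong (U₀-V a) (U₀-V b)))))
  (≈-trans (U₁-V _) (≈-sym (≈-trans (U-+ 1 (V a) (V b)) (≈-trans (+-cong (U₁-V a) (U₁-V b)) (+-identityʳ _)))))
  (≈-trans (U₂-V _) (≈-sym (≈-trans (U-+ 2 (V a) (V b)) (≈-trans (+-cong (U₂-V a) (U₂-V b)) (+-identityʳ _)))))

V-neg : ∀ a → V (- a) ≈ - V a
V-neg a = U-injective
  (≈-trans (U₀-V _) (≈-sym (≈-trans (U-neg 0 (V a)) (-‿cong (U₀-V a)))))
  (≈-trans (U₁-V _) (≈-sym (≈-trans (U-neg 1 (V a)) (≈-trans (-‿cong (U₁-V a)) neg-zero))))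
  (≈-trans (U₂-V _) (≈-sym (≈-trans (U-neg 2 (V a)) (≈-trans (-‿cong (U₂-V a)) neg-zero))))
  where
  neg-zero : - 0# ≈ 0#
  neg-zero = solve 0 (:- :con 0ℤ := :con 0ℤ) ≈-refl

V-* : ∀ a b → V (a * b) ≈ V a * V b
V-* a b = U-injective
  (≈-trans (U₀-V _) (≈-sym (≈-trans (U₀-V-* a (V b)) (*-congˡ a (U₀-V b)))))
  (≈-trans (U₁-V _) (≈-sym (≈-trans (U₁-V-* a (V b)) (≈-trans (*-congˡ a (U₁-V b)) (zeroʳ a)))))
  (≈-trans (U₂-V _) (≈-sym (≈-trans (U₂-V-* a (V b)) (≈-trans (*-congˡ a (U₂-V b)) (zeroʳ a)))))

V-1 : V 1# ≈ 1#
V-1 = V-con 1ℤ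

V-1-X : ∀ j → V (1# - X j) ≈ 1# - X (j ℕ.* 3)
V-1-X j = ≈-trans (V-+ 1# (- X j)) (+-cong V-1 (≈-trans (V-neg (X j)) (-‿cong (V-X j))))

U-- : ∀ r a b → U r (a - b) ≈ U r a - U r b
U-- r a b = ≈-trans (U-+ r a (- b)) (+-cong ≈-refl (U-neg r b))

module _ {a x y z : Series} (p : a ≈ V x + X 1 * V y + X 1 * (X 1 * V z)) where
  private
    split : ∀ r → U r a ≈ U r (V x) + U r (X 1 * V y) + U r (X 1 * (X 1 * V z))
    split r = ≈-trans (U-cong r p) (≈-trans (U-+ r _ _) (+-cong (U-+ r _ _) ≈-refl))

  U₀-component : U 0 a ≈ x
  U₀-component = ≈-trans (split 0) (≈-trans
    (+-cong (+-cong (U₀-V x) (≈-trans (U₀-X _) (*-congˡ (X 1) (U₂-V y))))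
      (≈-trans (U₀-X _) (*-congˡ (X 1) (≈-trans (U₂-X _) (U₁-V z)))))
    (solve 2 (λ x q → x :+ q :* :con 0ℤ :+ q :* :con 0ℤ := x) ≈-refl x (X 1)))

  U₁-component : U 1 a ≈ y
  U₁-component = ≈-trans (split 1) (≈-trans
    (+-cong (+-cong (U₁-V x) (≈-trans (U₁-X _) (U₀-V y)))
      (≈-trans (U₁-X _) (≈-trans (U₀-X _) (*-congˡ (X 1) (U₂-V z)))))
    (solve 2 (λ y q → :con 0ℤ :+ y :+ q :* :con 0ℤ := y) ≈-refl y (X 1)))

  U₂-component : U 2 a ≈ z
  U₂-component = ≈-trans (split 2) (≈-trans
    (+-cong (+-cong (U₂-V x) (≈-trans (U₂-X _) (U₁-V y)))
      (≈-trans (U₂-X _) (≈-trans (U₁-X _) (U₀-V z))))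
    (solve 1 (λ z → :con 0ℤ :+ :con 0ℤ :+ z := z) ≈-refl z))

dissection : ∀ a → a ≈ V (U 0 a) + X 1 * V (U 1 a) + X 1 * (X 1 * V (U 2 a))
dissection a = U-injective (≈-sym (U₀-component ≈-refl)) (≈-sym (U₁-component ≈-refl)) (≈-sym (U₂-component ≈-refl))

-- The norm of a from ℤ[[q]] to ℤ[[q³]], with q³ replaced by q.

circulant : Series → Series → Series → Series
circulant x y z = x * x * x + X 1 * (y * y * y) + X 1 * X 1 * (z * z * z) - con (+ 3) * X 1 * (x * y * z)

norm : Series → Series
norm a = circulant (U 0 a) (U 1 a) (U 2 a)

circulant-cong : ∀ {x x′ y y′ z z′} → x ≈ x′ → y ≈ y′ → z ≈ z′ → circulant x y z ≈ circulant x′ y′ z′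
circulant-cong p r t = +-cong
  (+-cong (+-cong (*-cong (*-cong p p) p) (*-congˡ (X 1) (*-cong (*-cong r r) r)))
    (*-congˡ (X 1 * X 1) (*-cong (*-cong t t) t)))
  (-‿cong (*-congˡ (con (+ 3) * X 1) (*-cong (*-cong p r) t)))

norm-cong : ∀ {a b} → a ≈ b → norm a ≈ norm b
norm-cong p = circulant-cong (U-cong 0 p) (U-cong 1 p) (U-cong 2 p)

tends-norm : ∀ {x a} → Tends x a → Tends (λ N → norm (x N)) (norm a)
tends-norm p = tends-+
  (tends-+ (tends-+ (tends-* (tends-* p₀ p₀) p₀) (tends-* (tends-constant (X 1)) (tends-* (tends-* p₁ p₁) p₁)))
    (tends-* (tends-constant (X 1 * X 1)) (tends-* (tends-* p₂ p₂) p₂)))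
  (tends-neg (tends-* (tends-constant (con (+ 3) * X 1)) (tends-* (tends-* p₀ p₁) p₂)))
  where
  p₀ = tends-U 0 p
  p₁ = tends-U 1 p
  p₂ = tends-U 2 p

-- Multiplicativity of the norm is established for factors x(q³), 1 - q x(q³) and 1 - q² x(q³) only:
-- these are the shapes of 1 - q^m for m ≡ 0, 1, 2 modulo 3, which is all that an infinite product
-- requires.
norm-V-* : ∀ x a → norm (V x * a) ≈ x * x * x * norm a
norm-V-* x a = ≈-trans (circulant-cong (U₀-V-* x a) (U₁-V-* x a) (U₂-V-* x a))
  (solve 5 (λ q x a b c →
     x :* a :* (x :* a) :* (x :* a) :+ q :* (x :* b :* (x :* b) :* (x :* b))
       :+ q :* q :* (x :* c :* (x :* c) :* (x :* c)) :- :con (+ 3) :* q :* (x :* a :* (x :* b) :* (x :* c)) :=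
     x :* x :* x :* (a :* a :* a :+ q :* (b :* b :* b) :+ q :* q :* (c :* c :* c) :- :con (+ 3) :* q :* (a :* b :* c)))
     ≈-refl (X 1) x (U 0 a) (U 1 a) (U 2 a))

norm-1-XV : ∀ x a → norm (a - X 1 * (V x * a)) ≈ (1# - X 1 * (x * x * x)) * norm a
norm-1-XV x a = ≈-trans
  (circulant-cong
    (≈-trans (U-- 0 a _) (+-cong ≈-refl (-‿cong (≈-trans (U₀-X _) (*-congˡ (X 1) (U₂-V-* x a))))))
    (≈-trans (U-- 1 a _) (+-cong ≈-refl (-‿cong (≈-trans (U₁-X _) (U₀-V-* x a)))))
    (≈-trans (U-- 2 a _) (+-cong ≈-refl (-‿cong (≈-trans (U₂-X _) (U₁-V-* x a))))))
  (solve 5 (λ q x a b c →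
     let a′ = a :- q :* (x :* c)
         b′ = b :- x :* a
         c′ = c :- x :* b in
     a′ :* a′ :* a′ :+ q :* (b′ :* b′ :* b′) :+ q :* q :* (c′ :* c′ :* c′) :- :con (+ 3) :* q :* (a′ :* b′ :* c′) :=
     (:con 1ℤ :- q :* (x :* x :* x)) :*
       (a :* a :* a :+ q :* (b :* b :* b) :+ q :* q :* (c :* c :* c) :- :con (+ 3) :* q :* (a :* b :* c)))
     ≈-refl (X 1) x (U 0 a) (U 1 a) (U 2 a))

norm-1-XXV : ∀ x a → norm (a - X 1 * (X 1 * (V x * a))) ≈ (1# - X 1 * X 1 * (x * x * x)) * norm a
norm-1-XXV x a = ≈-trans
  (circulant-cong
    (≈-trans (U-- 0 a _) (+-cong ≈-refl (-‿cong (≈-trans (U₀-X _) (*-congˡ (X 1) (≈-trans (U₂-X _) (U₁-V-* x a)))))))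
    (≈-trans (U-- 1 a _) (+-cong ≈-refl (-‿cong (≈-trans (U₁-X _) (≈-trans (U₀-X _) (*-congˡ (X 1) (U₂-V-* x a)))))))
    (≈-trans (U-- 2 a _) (+-cong ≈-refl (-‿cong (≈-trans (U₂-X _) (≈-trans (U₁-X _) (U₀-V-* x a)))))))
  (solve 5 (λ q x a b c →
     let a′ = a :- q :* (x :* b)
         b′ = b :- q :* (x :* c)
         c′ = c :- x :* a in
     a′ :* a′ :* a′ :+ q :* (b′ :* b′ :* b′) :+ q :* q :* (c′ :* c′ :* c′) :- :con (+ 3) :* q :* (a′ :* b′ :* c′) :=
     (:con 1ℤ :- q :* q :* (x :* x :* x)) :*
       (a :* a :* a :+ q :* (b :* b :* b) :+ q :* q :* (c :* c :* c) :- :con (+ 3) :* q :* (a :* b :* c)))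
     ≈-refl (X 1) x (U 0 a) (U 1 a) (U 2 a))

X-cube : ∀ j → X j * X j * X j ≈ X (j ℕ.* 3)
X-cube j = ≈-sym (≈-trans (X-cong (trans (ℕ.*-comm j 3) (trans (sym (ℕ.+-assoc j j (j ℕ.+ 0)))
  (cong (λ i → j ℕ.+ j ℕ.+ i) (ℕ.+-identityʳ j)))))
  (≈-trans (X-+ (j ℕ.+ j) j) (*-congʳ (X j) (X-+ j j))))

X-*3 : ∀ r j → X (r ℕ.+ j ℕ.* 3) ≈ X r * V (X j)
X-*3 r j = ≈-trans (X-+ r (j ℕ.* 3)) (*-congˡ (X r) (≈-sym (V-X j)))

NonMultipleOf3 : ℕ → Set
NonMultipleOf3 m = ∃ λ j → m ≡ 1 ℕ.+ j ℕ.* 3 ⊎ m ≡ 2 ℕ.+ j ℕ.* 3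

-- With ω a primitive cube root of unity, the conjugates of 1 - q^m are 1 - ω^(im) q^m. Their
-- product is 1 - q^(3m) when 3 does not divide m, and replacing q³ by q gives back 1 - q^m.
norm-1-X : ∀ {m} → NonMultipleOf3 m → ∀ a → norm ((1# - X m) * a) ≈ (1# - X m) * norm a
norm-1-X (j , inj₁ refl) a = ≈-trans
  (norm-cong (≈-trans (*-congʳ a (+-cong ≈-refl (-‿cong (X-*3 1 j))))
    (solve 3 (λ q x a → (:con 1ℤ :- q :* x) :* a := a :- q :* (x :* a)) ≈-refl (X 1) (V (X j)) a)))
  (≈-trans (norm-1-XV (X j) a)
    (*-congʳ (norm a) (+-cong ≈-refl (-‿cong (≈-trans (*-congˡ (X 1) (X-cube j)) (≈-sym (X-+ 1 (j ℕ.* 3))))))))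
norm-1-X (j , inj₂ refl) a = ≈-trans
  (norm-cong (≈-trans (*-congʳ a (+-cong ≈-refl (-‿cong (≈-trans (X-*3 2 j) (*-congʳ (V (X j)) (X-+ 1 1))))))
    (solve 3 (λ q x a → (:con 1ℤ :- q :* q :* x) :* a := a :- q :* (q :* (x :* a))) ≈-refl (X 1) (V (X j)) a)))
  (≈-trans (norm-1-XXV (X j) a)
    (*-congʳ (norm a) (+-cong ≈-refl (-‿cong (≈-trans (*-cong (≈-sym (X-+ 1 1)) (X-cube j)) (≈-sym (X-+ 2 (j ℕ.* 3))))))))

-- Factors 1 - q^(mk) with 3 ∤ m have themselves as norm, and 1 - q^(3mk) has norm (1 - q^(mk))³.
-- Multiplying by `V (p N)` restores the factors missing from the first kind. In the limit, with a =
-- 1, this says that the norm of f_k times f_(3k) is f_k⁴.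
norm-∏ : ∀ k → (∀ N → NonMultipleOf3 (suc (N ℕ.* 3) ℕ.* k)) → (∀ N → NonMultipleOf3 (suc (suc (N ℕ.* 3)) ℕ.* k)) →
  let p = ∏ (factor⁻ k k) in
  ∀ N a → norm (p (N ℕ.* 3) * a) * V (p N) ≈ p (N ℕ.* 3) * (p N * p N * p N) * norm a
norm-∏ k k₁ k₂ zero a = ≈-trans (*-cong (norm-cong (*-identityˡ a)) V-1)
  (solve 1 (λ x → let e = :con 1ℤ in x :* e := e :* (e :* e :* e) :* x) ≈-refl (norm a))
norm-∏ k k₁ k₂ (suc N) a = begin
  norm (w * (v * (u * P)) * a) * V (y * Q)
    ≈⟨ *-cong (norm-cong (solve 5 (λ w v u p a → w :* (v :* (u :* p)) :* a := w :* (v :* (u :* (p :* a)))) ≈-refl w v u P a))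
         (≈-trans (V-* y Q) (*-congʳ (V Q) (≈-trans (V-1-X (suc N ℕ.* k)) (≈-sym w≈)))) ⟩
  norm (w * (v * (u * (P * a)))) * (w * V Q)
    ≈⟨ *-congʳ (w * V Q) (≈-trans (norm-cong (*-congʳ _ (≈-trans w≈ (≈-sym (V-1-X (suc N ℕ.* k)))))) (norm-V-* y _)) ⟩
  y * y * y * norm (v * (u * (P * a))) * (w * V Q)
    ≈⟨ *-congʳ (w * V Q) (*-congˡ (y * y * y) (≈-trans (norm-1-X (k₂ N) (u * (P * a)))
         (*-congˡ v (norm-1-X (k₁ N) (P * a))))) ⟩
  y * y * y * (v * (u * norm (P * a))) * (w * V Q)
    ≈⟨ solve 6 (λ y v u n w q → y :* y :* y :* (v :* (u :* n)) :* (w :* q) := y :* y :* y :* v :* u :* w :* (n :* q)) ≈-refl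
         y v u (norm (P * a)) w (V Q) ⟩
  y * y * y * v * u * w * (norm (P * a) * V Q)
    ≈⟨ *-congˡ (y * y * y * v * u * w) (norm-∏ k k₁ k₂ N a) ⟩
  y * y * y * v * u * w * (P * (Q * Q * Q) * norm a)
    ≈⟨ solve 7 (λ y v u w p q n → y :* y :* y :* v :* u :* w :* (p :* (q :* q :* q) :* n) :=
         w :* (v :* (u :* p)) :* (y :* q :* (y :* q) :* (y :* q)) :* n) ≈-refl y v u w P Q (norm a) ⟩
  w * (v * (u * P)) * (y * Q * (y * Q) * (y * Q)) * norm a
    ∎
  where
  P = ∏ (factor⁻ k k) (N ℕ.* 3)
  Q = ∏ (factor⁻ k k) N
  u = factor⁻ k k (N ℕ.* 3)
  v = factor⁻ k k (suc (N ℕ.* 3))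
  w = factor⁻ k k (suc (suc (N ℕ.* 3)))
  y = factor⁻ k k N
  w≈ : w ≈ 1# - X (suc N ℕ.* k ℕ.* 3)
  w≈ = +-cong ≈-refl (-‿cong (X-cong (trans (ℕ.*-assoc (suc N) 3 k)
    (trans (cong (suc N ℕ.*_) (ℕ.*-comm 3 k)) (sym (ℕ.*-assoc (suc N) k 3))))))

-- Infinite products and theta series

∏-cong : ∀ {u v} → (∀ m → u m ≈ v m) → ∀ N → ∏ u N ≈ ∏ v N
∏-cong u≈v zero    = ≈-refl
∏-cong u≈v (suc N) = *-cong (u≈v N) (∏-cong u≈v N)

∏-* : ∀ u v N → ∏ u N * ∏ v N ≈ ∏ (λ m → u m * v m) N
∏-* u v zero    = *-identityˡ 1#
∏-* u v (suc N) = ≈-trans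
  (solve 4 (λ a b c d → a :* b :* (c :* d) := a :* c :* (b :* d)) ≈-refl (u N) (∏ u N) (v N) (∏ v N))
  (*-congˡ (u N * v N) (∏-* u v N))

∏-even-odd : ∀ u N → ∏ u (N ℕ.* 2) ≈ ∏ (λ m → u (m ℕ.* 2)) N * ∏ (λ m → u (suc (m ℕ.* 2))) N
∏-even-odd u zero    = ≈-sym (*-identityˡ 1#)
∏-even-odd u (suc N) = ≈-trans (*-congˡ _ (*-congˡ _ (∏-even-odd u N)))
  (solve 4 (λ a b c d → a :* (b :* (c :* d)) := b :* c :* (a :* d)) ≈-refl
    (u (suc (N ℕ.* 2))) (u (N ℕ.* 2)) (∏ (λ m → u (m ℕ.* 2)) N) (∏ (λ m → u (suc (m ℕ.* 2))) N))

-- The q-Pochhammer symbols (q^r; q^s)∞ and (-q^r; q^s)∞.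
G⁻ G⁺ : ℕ → ℕ → Series
G⁻ r s = lim (∏ (factor⁻ r s))
G⁺ r s = lim (∏ (factor⁺ r s))

module _ (r s : ℕ) .{{_ : ℕ.NonZero s}} where
  private
    m≤r+ms : ∀ m → m ℕ.≤ r ℕ.+ m ℕ.* s
    m≤r+ms m = ℕ.≤-trans (ℕ.m≤m*n m s) (ℕ.m≤n+m (m ℕ.* s) r)

  tends-G⁻ : Tends (∏ (factor⁻ r s)) (G⁻ r s)
  tends-G⁻ = tends-∏ (factor⁻ r s) λ m →
    ≈[]-trans (+-cong[] (≈[]-refl {a = 1#}) (neg-cong[] (X-vanishes (m≤r+ms m))))
      (≈⇒≈[] (solve 0 (:con 1ℤ :- :con 0ℤ := :con 1ℤ) ≈-refl))

  tends-G⁺ : Tends (∏ (factor⁺ r s)) (G⁺ r s)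
  tends-G⁺ = tends-∏ (factor⁺ r s) λ m →
    ≈[]-trans (+-cong[] (≈[]-refl {a = 1#}) (X-vanishes (m≤r+ms m))) (≈⇒≈[] (+-identityʳ 1#))

G⁻-zero : ∀ r s → G⁻ (suc r) s 0 ≡ 1ℤ
G⁻-zero r s = lim-∏-zero (factor⁻ (suc r) s) λ m → 1-X-zero (r ℕ.+ m ℕ.* s)

module _ (r s : ℕ) .{{_ : ℕ.NonZero s}} .{{_ : ℕ.NonZero (s ℕ.* 2)}} where

  G⁻*G⁺ : G⁻ r s * G⁺ r s ≈ G⁻ (r ℕ.* 2) (s ℕ.* 2)
  G⁻*G⁺ = tends-unique (tends-* (tends-G⁻ r s) (tends-G⁺ r s)) (tends-G⁻ (r ℕ.* 2) (s ℕ.* 2)) λ N →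
    ≈-trans (∏-* (factor⁻ r s) (factor⁺ r s) N) (∏-cong (λ m →
      ≈-trans (solve 1 (λ x → (:con 1ℤ :- x) :* (:con 1ℤ :+ x) := :con 1ℤ :- x :* x) ≈-refl (X (r ℕ.+ m ℕ.* s)))
        (+-cong ≈-refl (-‿cong (≈-trans (≈-sym (X-+ (r ℕ.+ m ℕ.* s) (r ℕ.+ m ℕ.* s))) (X-cong (double r s m)))))) N)
    where
    double : ∀ r s m → r ℕ.+ m ℕ.* s ℕ.+ (r ℕ.+ m ℕ.* s) ≡ r ℕ.* 2 ℕ.+ m ℕ.* (s ℕ.* 2)
    double = solve-∀

  G⁻-even-odd : G⁻ r s ≈ G⁻ r (s ℕ.* 2) * G⁻ (r ℕ.+ s) (s ℕ.* 2)
  G⁻-even-odd = tends-unique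
    (tends-subsequence (ℕ._* 2) (λ N → ℕ.m≤m*n N 2) (tends-G⁻ r s))
    (tends-* (tends-G⁻ r (s ℕ.* 2)) (tends-G⁻ (r ℕ.+ s) (s ℕ.* 2))) λ N →
    ≈-trans (∏-even-odd (factor⁻ r s) N) (*-cong
      (∏-cong (λ m → +-cong ≈-refl (-‿cong (X-cong (even r s m)))) N)
      (∏-cong (λ m → +-cong ≈-refl (-‿cong (X-cong (odd r s m)))) N))
    where
    even : ∀ r s m → r ℕ.+ m ℕ.* 2 ℕ.* s ≡ r ℕ.+ m ℕ.* (s ℕ.* 2)
    even = solve-∀
    odd : ∀ r s m → r ℕ.+ suc (m ℕ.* 2) ℕ.* s ≡ r ℕ.+ s ℕ.+ m ℕ.* (s ℕ.* 2)
    odd = solve-∀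

module _ (k : ℕ) .{{_ : ℕ.NonZero k}} where

  f≈G⁻ : f k ≈ G⁻ k k
  f≈G⁻ = tends-unique tends-f (tends-G⁻ k k) partialProduct≈∏
    where
    tends-f : Tends (partialProduct k) (f k)
    tends-f K = K , λ N K≤N → pointwise< λ n n<K →
      subst (λ M → partialProduct k M n ≡ f k n) (ℕ.m∸n+n≡m (ℕ.≤-trans (ℕ.<⇒≤ n<K) K≤N))
        (f-limit k n (N ℕ.∸ n))
    1-q≈ : ∀ j → 1-q^ j ≈ 1# - X j
    1-q≈ j = pointwise λ n → sym (trans (+-at 1# (- X j) n)
      (cong₂ _+ᶻ_ (trans (sym (at X-0 n)) (cong (λ x → x n) (X-q^ 0)))
        (trans (neg-at (X j) n) (cong (λ x → -ᶻ x n) (X-q^ j)))))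
    partialProduct≈∏ : ∀ N → partialProduct k N ≈ ∏ (factor⁻ k k) N
    partialProduct≈∏ zero    = subst (_≈ 1#) (X-q^ 0) X-0
    partialProduct≈∏ (suc N) = ≈-trans (pointwise λ n → sym (*-⊛ (1-q^ (k ℕ.* suc N)) (partialProduct k N) n))
      (*-cong (≈-trans (1-q≈ (k ℕ.* suc N)) (+-cong ≈-refl (-‿cong (X-cong (ℕ.*-comm k (suc N))))))
        (partialProduct≈∏ N))

  V-G⁻ : .{{_ : ℕ.NonZero (k ℕ.* 3)}} → V (G⁻ k k) ≈ G⁻ (k ℕ.* 3) (k ℕ.* 3)
  V-G⁻ = tends-unique (tends-V (tends-G⁻ k k)) (tends-G⁻ (k ℕ.* 3) (k ℕ.* 3)) go
    where
    triple : ∀ k m → (k ℕ.+ m ℕ.* k) ℕ.* 3 ≡ k ℕ.* 3 ℕ.+ m ℕ.* (k ℕ.* 3)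
    triple = solve-∀
    go : ∀ N → V (∏ (factor⁻ k k) N) ≈ ∏ (factor⁻ (k ℕ.* 3) (k ℕ.* 3)) N
    go zero    = V-1
    go (suc N) = ≈-trans (V-* (factor⁻ k k N) (∏ (factor⁻ k k) N))
      (*-cong (≈-trans (V-1-X (k ℕ.+ N ℕ.* k)) (+-cong ≈-refl (-‿cong (X-cong (triple k N))))) (go N))

  norm-G⁻-* : (∀ N → NonMultipleOf3 (suc (N ℕ.* 3) ℕ.* k)) → (∀ N → NonMultipleOf3 (suc (suc (N ℕ.* 3)) ℕ.* k)) →
    ∀ a → norm (G⁻ k k * a) * V (G⁻ k k) ≈ G⁻ k k * (G⁻ k k * G⁻ k k * G⁻ k k) * norm a
  norm-G⁻-* k₁ k₂ a = tends-unique
    (tends-* (tends-norm (tends-* p₃ (tends-constant a))) (tends-V p))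
    (tends-* (tends-* p₃ (tends-* (tends-* p p) p)) (tends-constant (norm a)))
    (λ N → norm-∏ k k₁ k₂ N a)
    where
    p = tends-G⁻ k k
    p₃ = tends-subsequence (ℕ._* 3) (λ N → ℕ.m≤m*n N 3) p

-- exponent a s n = a n + s n(n-1)/2
exponent : ℕ → ℕ → ℕ → ℕ
exponent a s zero    = 0
exponent a s (suc n) = exponent a s n ℕ.+ (a ℕ.+ n ℕ.* s)

sign : ℕ → Series
sign zero    = 1#
sign (suc n) = - sign n

module _ (s-1 : ℕ) (A B : Series) (AB≈Q : A * B ≈ X (suc s-1)) where
  open JacobiTripleProduct s-1 A B AB≈Q
  private s = suc s-1

  term-X : ∀ a n → term (X a) n ≈ X (exponent a s n)
  term-X a zero    = ≈-sym X-0
  term-X a (suc n) = ≈-trans (*-cong (term-X a n) (≈-sym (X-+ a (n ℕ.* s))))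
    (≈-sym (X-+ (exponent a s n) (a ℕ.+ n ℕ.* s)))

  term-neg-X : ∀ a n → term (- X a) n ≈ sign n * X (exponent a s n)
  term-neg-X a zero    = ≈-sym (≈-trans (*-identityˡ (X 0)) X-0)
  term-neg-X a (suc n) = begin
    term (- X a) n * (- X a * X (n ℕ.* s))
      ≈⟨ *-congʳ _ (term-neg-X a n) ⟩
    sign n * X (exponent a s n) * (- X a * X (n ℕ.* s))
      ≈⟨ solve 4 (λ σ e a x → σ :* e :* (:- a :* x) := :- σ :* (e :* (a :* x))) ≈-refl
           (sign n) (X (exponent a s n)) (X a) (X (n ℕ.* s)) ⟩
    - sign n * (X (exponent a s n) * (X a * X (n ℕ.* s)))
      ≈⟨ *-congˡ (- sign n) (*-congˡ _ (X-+ a (n ℕ.* s))) ⟨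
    - sign n * (X (exponent a s n) * X (a ℕ.+ n ℕ.* s))
      ≈⟨ *-congˡ (- sign n) (X-+ (exponent a s n) (a ℕ.+ n ℕ.* s)) ⟨
    sign (suc n) * X (exponent a s (suc n))
      ∎

  tends-factor⁺ : ∀ a → Tends (∏ (factor (X a))) (G⁺ a s)
  tends-factor⁺ a = tends-cong (∏-cong λ m → +-cong ≈-refl (X-+ a (m ℕ.* s))) (tends-G⁺ a s)

  tends-factor⁻ : ∀ a → Tends (∏ (factor (- X a))) (G⁻ a s)
  tends-factor⁻ a = tends-cong (∏-cong λ m → ≈-trans (+-cong ≈-refl (-‿cong (X-+ a (m ℕ.* s))))
    (solve 2 (λ a x → :con 1ℤ :- a :* x := :con 1ℤ :+ (:- a) :* x) ≈-refl (X a) (X (m ℕ.* s)))) (tends-G⁻ a s)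

neg-*-neg : ∀ a b → - X a * - X b ≈ X (a ℕ.+ b)
neg-*-neg a b = ≈-trans (solve 2 (λ x y → (:- x) :* (:- y) := x :* y) ≈-refl (X a) (X b)) (≈-sym (X-+ a b))

-- In Ramanujan's notation f(a,b), these are φ(-q) = f(-q,-q), ψ(q) = f(q,q³),
-- f(-q⁵,-q) and f(q,q²).

module φ = JacobiTripleProduct 1 (- X 1) (- X 1) (neg-*-neg 1 1)
module ψ = JacobiTripleProduct 3 (X 1) (X 3) (≈-sym (X-+ 1 3))
module Ω = JacobiTripleProduct 5 (- X 5) (- X 1) (neg-*-neg 5 1)
module Π = JacobiTripleProduct 2 (X 1) (X 2) (≈-sym (X-+ 1 2))

Φ Ψ Ω∞ Π∞ : Series
Φ  = G⁻ 2 2 * (G⁻ 1 2 * G⁻ 1 2)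
Ψ  = G⁻ 4 4 * (G⁺ 1 4 * G⁺ 3 4)
Ω∞ = G⁻ 6 6 * (G⁻ 5 6 * G⁻ 1 6)
Π∞ = G⁻ 3 3 * (G⁺ 1 3 * G⁺ 2 3)

tends-φ : Tends φ.θ Φ
tends-φ = φ.tends-θ
  (tends-factor⁻ _ _ _ (neg-*-neg 1 1) 1)
  (tends-factor⁻ _ _ _ (neg-*-neg 1 1) 1)
  (tends-G⁻ 2 2) (G⁻-zero 1 2)

tends-ψ : Tends ψ.θ Ψ
tends-ψ = ψ.tends-θ
  (tends-factor⁺ _ _ _ (≈-sym (X-+ 1 3)) 1)
  (tends-factor⁺ _ _ _ (≈-sym (X-+ 1 3)) 3)
  (tends-G⁻ 4 4) (G⁻-zero 3 4)

tends-Ω : Tends Ω.θ Ω∞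
tends-Ω = Ω.tends-θ
  (tends-factor⁻ _ _ _ (neg-*-neg 5 1) 5)
  (tends-factor⁻ _ _ _ (neg-*-neg 5 1) 1)
  (tends-G⁻ 6 6) (G⁻-zero 5 6)

tends-Π : Tends Π.θ Π∞
tends-Π = Π.tends-θ
  (tends-factor⁺ _ _ _ (≈-sym (X-+ 1 2)) 1)
  (tends-factor⁺ _ _ _ (≈-sym (X-+ 1 2)) 2)
  (tends-G⁻ 3 3) (G⁻-zero 2 3)

-- Splitting the exponents of φ(-q) and ψ(q) modulo 3

private
  exponent-3 : ∀ a s n → exponent a s (3 ℕ.+ n) ≡ exponent a s n ℕ.+ ((3 ℕ.* a) ℕ.+ (3 ℕ.* n ℕ.+ 3) ℕ.* s)
  exponent-3 a s n = lemma (exponent a s n) a s n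
    where
    lemma : ∀ e a s n → e ℕ.+ (a ℕ.+ n ℕ.* s) ℕ.+ (a ℕ.+ (1 ℕ.+ n) ℕ.* s) ℕ.+ (a ℕ.+ (2 ℕ.+ n) ℕ.* s)
                      ≡ e ℕ.+ ((3 ℕ.* a) ℕ.+ (3 ℕ.* n ℕ.+ 3) ℕ.* s)
    lemma = solve-∀

tri : ℕ → ℕ
tri = exponent 1 1

tri-even : ∀ n → exponent 3 4 n ≡ tri (n ℕ.* 2)
tri-even zero    = refl
tri-even (suc n) = trans (cong (ℕ._+ (3 ℕ.+ n ℕ.* 4)) (tri-even n)) (lemma (tri (n ℕ.* 2)) n)
  where
  lemma : ∀ e n → e ℕ.+ (3 ℕ.+ n ℕ.* 4) ≡ e ℕ.+ (1 ℕ.+ n ℕ.* 2 ℕ.* 1) ℕ.+ (1 ℕ.+ suc (n ℕ.* 2) ℕ.* 1)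
  lemma = solve-∀

tri-odd : ∀ n → exponent 1 4 (suc n) ≡ tri (suc (n ℕ.* 2))
tri-odd zero    = refl
tri-odd (suc n) = trans (cong (ℕ._+ (1 ℕ.+ suc n ℕ.* 4)) (tri-odd n)) (lemma (tri (suc (n ℕ.* 2))) n)
  where
  lemma : ∀ e n → e ℕ.+ (1 ℕ.+ suc n ℕ.* 4)
                ≡ e ℕ.+ (1 ℕ.+ suc (n ℕ.* 2) ℕ.* 1) ℕ.+ (1 ℕ.+ suc (suc (n ℕ.* 2)) ℕ.* 1)
  lemma = solve-∀

-- The indices 3n and 3n + 2 give three times the generalised pentagonal numbers, the exponents of
-- f(q,q²); the index 3n + 1 gives 1 + 9 `tri n`, which reproduces ψ at q⁹.
tri-0mod3 : ∀ n → tri (n ℕ.* 3) ≡ exponent 2 3 n ℕ.* 3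
tri-0mod3 zero    = refl
tri-0mod3 (suc n) = trans (exponent-3 1 1 (n ℕ.* 3))
  (trans (cong (ℕ._+ (3 ℕ.+ (3 ℕ.* (n ℕ.* 3) ℕ.+ 3) ℕ.* 1)) (tri-0mod3 n)) (lemma (exponent 2 3 n) n))
  where
  lemma : ∀ e n → e ℕ.* 3 ℕ.+ (3 ℕ.+ (3 ℕ.* (n ℕ.* 3) ℕ.+ 3) ℕ.* 1) ≡ (e ℕ.+ (2 ℕ.+ n ℕ.* 3)) ℕ.* 3
  lemma = solve-∀

tri-1mod3 : ∀ n → tri (1 ℕ.+ n ℕ.* 3) ≡ 1 ℕ.+ tri n ℕ.* 3 ℕ.* 3
tri-1mod3 zero    = refl
tri-1mod3 (suc n) = trans (exponent-3 1 1 (1 ℕ.+ n ℕ.* 3))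
  (trans (cong (ℕ._+ (3 ℕ.+ (3 ℕ.* (1 ℕ.+ n ℕ.* 3) ℕ.+ 3) ℕ.* 1)) (tri-1mod3 n)) (lemma (tri n) n))
  where
  lemma : ∀ e n → 1 ℕ.+ e ℕ.* 3 ℕ.* 3 ℕ.+ (3 ℕ.+ (3 ℕ.* (1 ℕ.+ n ℕ.* 3) ℕ.+ 3) ℕ.* 1)
                ≡ 1 ℕ.+ (e ℕ.+ (1 ℕ.+ n ℕ.* 1)) ℕ.* 3 ℕ.* 3
  lemma = solve-∀

tri-2mod3 : ∀ n → tri (2 ℕ.+ n ℕ.* 3) ≡ exponent 1 3 (suc n) ℕ.* 3
tri-2mod3 zero    = refl
tri-2mod3 (suc n) = trans (exponent-3 1 1 (2 ℕ.+ n ℕ.* 3))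
  (trans (cong (ℕ._+ (3 ℕ.+ (3 ℕ.* (2 ℕ.+ n ℕ.* 3) ℕ.+ 3) ℕ.* 1)) (tri-2mod3 n)) (lemma (exponent 1 3 (suc n)) n))
  where
  lemma : ∀ e n → e ℕ.* 3 ℕ.+ (3 ℕ.+ (3 ℕ.* (2 ℕ.+ n ℕ.* 3) ℕ.+ 3) ℕ.* 1) ≡ (e ℕ.+ (1 ℕ.+ suc n ℕ.* 3)) ℕ.* 3
  lemma = solve-∀

square : ℕ → ℕ
square = exponent 1 2

square-0mod3 : ∀ n → square (n ℕ.* 3) ≡ square n ℕ.* 3 ℕ.* 3
square-0mod3 zero    = refl
square-0mod3 (suc n) = trans (exponent-3 1 2 (n ℕ.* 3))
  (trans (cong (ℕ._+ (3 ℕ.+ (3 ℕ.* (n ℕ.* 3) ℕ.+ 3) ℕ.* 2)) (square-0mod3 n)) (lemma (square n) n))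
  where
  lemma : ∀ e n → e ℕ.* 3 ℕ.* 3 ℕ.+ (3 ℕ.+ (3 ℕ.* (n ℕ.* 3) ℕ.+ 3) ℕ.* 2)
                ≡ (e ℕ.+ (1 ℕ.+ n ℕ.* 2)) ℕ.* 3 ℕ.* 3
  lemma = solve-∀

-- The exponents here and in the next class are the values of m(3m + 2) at m = n and m = -(n + 1):
-- the two halves of f(-q⁵,-q).
square-1mod3 : ∀ n → square (1 ℕ.+ n ℕ.* 3) ≡ 1 ℕ.+ exponent 5 6 n ℕ.* 3
square-1mod3 zero    = refl
square-1mod3 (suc n) = trans (exponent-3 1 2 (1 ℕ.+ n ℕ.* 3))
  (trans (cong (ℕ._+ (3 ℕ.+ (3 ℕ.* (1 ℕ.+ n ℕ.* 3) ℕ.+ 3) ℕ.* 2)) (square-1mod3 n)) (lemma (exponent 5 6 n) n))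
  where
  lemma : ∀ e n → 1 ℕ.+ e ℕ.* 3 ℕ.+ (3 ℕ.+ (3 ℕ.* (1 ℕ.+ n ℕ.* 3) ℕ.+ 3) ℕ.* 2) 
                ≡ 1 ℕ.+ (e ℕ.+ (5 ℕ.+ n ℕ.* 6)) ℕ.* 3
  lemma = solve-∀

square-2mod3 : ∀ n → square (2 ℕ.+ n ℕ.* 3) ≡ 1 ℕ.+ exponent 1 6 (suc n) ℕ.* 3
square-2mod3 zero    = refl
square-2mod3 (suc n) = trans (exponent-3 1 2 (2 ℕ.+ n ℕ.* 3))
  (trans (cong (ℕ._+ (3 ℕ.+ (3 ℕ.* (2 ℕ.+ n ℕ.* 3) ℕ.+ 3) ℕ.* 2)) (square-2mod3 n)) (lemma (exponent 1 6 (suc n)) n))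
  where
  lemma : ∀ e n → 1 ℕ.+ e ℕ.* 3 ℕ.+ (3 ℕ.+ (3 ℕ.* (2 ℕ.+ n ℕ.* 3) ℕ.+ 3) ℕ.* 2) 
                ≡ 1 ℕ.+ (e ℕ.+ (1 ℕ.+ suc n ℕ.* 6)) ℕ.* 3
  lemma = solve-∀

neg-neg : ∀ a → - - a ≈ a
neg-neg = solve 1 (λ a → :- (:- a) := a) ≈-refl

sign-triple : ∀ n → sign (n ℕ.* 3) ≈ sign n
sign-triple zero    = ≈-refl
sign-triple (suc n) = -‿cong (≈-trans (neg-neg (sign (n ℕ.* 3))) (sign-triple n))

V-sign : ∀ n → V (sign n) ≈ sign n
V-sign zero    = V-1
V-sign (suc n) = ≈-trans (V-neg (sign n)) (-‿cong (V-sign n))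

V-sign-X : ∀ n e → V (sign n * X e) ≈ sign n * X (e ℕ.* 3)
V-sign-X n e = ≈-trans (V-* (sign n) (X e)) (*-cong (V-sign n) (V-X e))

private
  t² : ℕ → Series
  t² = φ.term (- X 1)

  t²-X : ∀ n → t² n ≈ sign n * X (square n)
  t²-X = term-neg-X 1 (- X 1) (- X 1) (neg-*-neg 1 1) 1

  t²-0mod3 : ∀ n → t² (n ℕ.* 3) ≈ V (V (t² n))
  t²-0mod3 n = ≈-trans (t²-X (n ℕ.* 3)) (≈-trans
    (*-cong (sign-triple n) (X-cong (square-0mod3 n)))
    (≈-sym (≈-trans (V-cong (≈-trans (V-cong (t²-X n)) (V-sign-X n (square n)))) (V-sign-X n (square n ℕ.* 3)))))

  t²-1mod3 : ∀ n → t² (1 ℕ.+ n ℕ.* 3) ≈ - (X 1 * V (Ω.term (- X 5) n))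
  t²-1mod3 n = begin
    t² (1 ℕ.+ n ℕ.* 3)
      ≈⟨ t²-X (1 ℕ.+ n ℕ.* 3) ⟩
    - sign (n ℕ.* 3) * X (square (1 ℕ.+ n ℕ.* 3))
      ≈⟨ *-cong (-‿cong (sign-triple n)) (≈-trans (X-cong (square-1mod3 n)) (X-+ 1 _)) ⟩
    - sign n * (X 1 * X (exponent 5 6 n ℕ.* 3))
      ≈⟨ solve 3 (λ σ q x → :- σ :* (q :* x) := :- (q :* (σ :* x))) ≈-refl (sign n) (X 1) (X (exponent 5 6 n ℕ.* 3)) ⟩
    - (X 1 * (sign n * X (exponent 5 6 n ℕ.* 3)))
      ≈⟨ -‿cong (*-congˡ (X 1) (≈-trans (V-cong (term-neg-X 5 _ _ (neg-*-neg 5 1) 5 n)) (V-sign-X n (exponent 5 6 n)))) ⟨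
    - (X 1 * V (Ω.term (- X 5) n))
      ∎

  t²-2mod3 : ∀ n → t² (2 ℕ.+ n ℕ.* 3) ≈ - (X 1 * V (Ω.term (- X 1) (suc n)))
  t²-2mod3 n = begin
    t² (2 ℕ.+ n ℕ.* 3)
      ≈⟨ t²-X (2 ℕ.+ n ℕ.* 3) ⟩
    - - sign (n ℕ.* 3) * X (square (2 ℕ.+ n ℕ.* 3))
      ≈⟨ *-cong (-‿cong (-‿cong (sign-triple n))) (≈-trans (X-cong (square-2mod3 n)) (X-+ 1 _)) ⟩
    - - sign n * (X 1 * X (exponent 1 6 (suc n) ℕ.* 3))
      ≈⟨ solve 3 (λ σ q x → :- (:- σ) :* (q :* x) := :- (q :* (:- σ :* x))) ≈-refl
           (sign n) (X 1) (X (exponent 1 6 (suc n) ℕ.* 3)) ⟩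
    - (X 1 * (sign (suc n) * X (exponent 1 6 (suc n) ℕ.* 3)))
      ≈⟨ -‿cong (*-congˡ (X 1) (≈-trans (V-cong (term-neg-X 5 _ _ (neg-*-neg 5 1) 1 (suc n)))
           (V-sign-X (suc n) (exponent 1 6 (suc n))))) ⟨
    - (X 1 * V (Ω.term (- X 1) (suc n)))
      ∎

  -- Cutting φ at 3N + 1 makes each residue class an exact partial sum, without a remainder. The
  -- factor 2 arises because n and -n have the same square, so the class 1 modulo 3 of the exponents
  -- is met twice.
  φ-partial : ∀ N → φ.θ (1 ℕ.+ N ℕ.* 3) ≈ V (V (φ.θ N)) - con (+ 2) * (X 1 * V (Ω.θ N))
  φ-partial zero = begin
    1# + (t² 1 + t² 1)
      ≈⟨ +-cong ≈-refl (+-cong (t²-1mod3 0) (t²-1mod3 0)) ⟩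
    1# + (- (X 1 * V 1#) + - (X 1 * V 1#))
      ≈⟨ solve 2 (λ q v → :con 1ℤ :+ (:- (q :* v) :+ :- (q :* v)) := :con 1ℤ :- :con (+ 2) :* (q :* v)) ≈-refl (X 1) (V 1#) ⟩
    1# - con (+ 2) * (X 1 * V 1#)
      ≈⟨ +-cong (≈-trans (V-cong V-1) V-1) ≈-refl ⟨
    V (V 1#) - con (+ 2) * (X 1 * V 1#)
      ∎
  φ-partial (suc N) = begin
    φ.θ (1 ℕ.+ N ℕ.* 3) + (t² (2 ℕ.+ N ℕ.* 3) + t² (2 ℕ.+ N ℕ.* 3))
      + (t² (suc N ℕ.* 3) + t² (suc N ℕ.* 3)) + (t² (1 ℕ.+ suc N ℕ.* 3) + t² (1 ℕ.+ suc N ℕ.* 3))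
      ≈⟨ +-cong (+-cong (+-cong (φ-partial N) (+-cong (t²-2mod3 N) (t²-2mod3 N)))
           (+-cong (t²-0mod3 (suc N)) (t²-0mod3 (suc N)))) (+-cong (t²-1mod3 (suc N)) (t²-1mod3 (suc N))) ⟩
    V (V (φ.θ N)) - con (+ 2) * (X 1 * V (Ω.θ N)) + (- (X 1 * V b) + - (X 1 * V b))
      + (V (V c) + V (V c)) + (- (X 1 * V a) + - (X 1 * V a))
      ≈⟨ solve 6 (λ q p w a b c →
           p :- :con (+ 2) :* (q :* w) :+ (:- (q :* b) :+ :- (q :* b)) :+ (c :+ c) :+ (:- (q :* a) :+ :- (q :* a)) :=
           p :+ (c :+ c) :- :con (+ 2) :* (q :* (w :+ (a :+ b)))) ≈-refl
           (X 1) (V (V (φ.θ N))) (V (Ω.θ N)) (V a) (V b) (V (V c)) ⟩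
    V (V (φ.θ N)) + (V (V c) + V (V c)) - con (+ 2) * (X 1 * (V (Ω.θ N) + (V a + V b)))
      ≈⟨ +-cong (≈-trans (V-cong (≈-trans (V-+ _ _) (+-cong ≈-refl (V-+ _ _)))) (≈-trans (V-+ _ _) (+-cong ≈-refl (V-+ _ _))))
           (-‿cong (*-congˡ (con (+ 2)) (*-congˡ (X 1) (≈-trans (V-+ _ _) (+-cong ≈-refl (V-+ _ _)))))) ⟨
    V (V (φ.θ (suc N))) - con (+ 2) * (X 1 * V (Ω.θ (suc N)))
      ∎
    where
    a = Ω.term (- X 5) (suc N)
    b = Ω.term (- X 1) (suc N)
    c = t² (suc N)

Φ-dissection : Φ ≈ V (V Φ) - con (+ 2) * (X 1 * V Ω∞)
Φ-dissection = tends-unique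
  (tends-subsequence (λ N → 1 ℕ.+ N ℕ.* 3) (λ N → ℕ.≤-trans (ℕ.m≤m*n N 3) (ℕ.n≤1+n _)) tends-φ)
  (tends-+ (tends-V (tends-V tends-φ))
    (tends-neg (tends-* (tends-constant (con (+ 2))) (tends-* (tends-constant (X 1)) (tends-V tends-Ω)))))
  φ-partial

-- ψ as a one-sided sum over triangular numbers. The two halves of f(q,q³) run through those of odd
-- and of even index; splitting modulo 3 needs them merged in one sequence.
triSum : ℕ → Series
triSum zero    = X 0
triSum (suc N) = triSum N + X (tri (suc N))

ψ-triSum : ∀ N → ψ.θ N ≈ triSum (N ℕ.* 2)
ψ-triSum zero    = ≈-sym X-0
ψ-triSum (suc N) = ≈-trans
  (+-cong (ψ-triSum N) (+-cong
    (≈-trans (term-X 3 (X 1) (X 3) (≈-sym (X-+ 1 3)) 1 (suc N)) (X-cong (tri-odd N)))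
    (≈-trans (term-X 3 (X 1) (X 3) (≈-sym (X-+ 1 3)) 3 (suc N)) (X-cong (tri-even (suc N))))))
  (solve 3 (λ a b c → a :+ (b :+ c) := a :+ b :+ c) ≈-refl
    (triSum (N ℕ.* 2)) (X (tri (suc (N ℕ.* 2)))) (X (tri (suc N ℕ.* 2))))

tends-triSum-even : Tends (λ N → triSum (N ℕ.* 2)) Ψ
tends-triSum-even = tends-cong ψ-triSum tends-ψ

-- The dissection of ψ cuts at an index 1 + 3M. Taking M = 2N, where the right side is an even
-- partial sum, makes this index odd.
tends-triSum-odd : Tends (λ N → triSum (suc (N ℕ.* 2))) Ψ
tends-triSum-odd K = let N₀ , p = tends-+ tends-triSum-even (tends-X-0 (λ N → tri (suc (N ℕ.* 2))) N≤tri) K in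
  N₀ , λ N N₀≤N → ≈[]-trans (p N N₀≤N) (≈⇒≈[] (+-identityʳ Ψ))
  where
  n≤tri : ∀ n → n ℕ.≤ tri n
  n≤tri zero    = z≤n
  n≤tri (suc n) = ℕ.≤-trans (s≤s (ℕ.m≤m*n n 1)) (ℕ.m≤n+m (1 ℕ.+ n ℕ.* 1) (tri n))
  N≤tri : ∀ N → N ℕ.≤ tri (suc (N ℕ.* 2))
  N≤tri N = ℕ.≤-trans (ℕ.≤-trans (ℕ.m≤m*n N 2) (ℕ.n≤1+n _)) (n≤tri (suc (N ℕ.* 2)))

private
  Π-term₁ : ∀ n → Π.term (X 1) n ≈ X (exponent 1 3 n)
  Π-term₁ = term-X 2 (X 1) (X 2) (≈-sym (X-+ 1 2)) 1

  Π-term₂ : ∀ n → Π.term (X 2) n ≈ X (exponent 2 3 n)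
  Π-term₂ = term-X 2 (X 1) (X 2) (≈-sym (X-+ 1 2)) 2

  VV-X : ∀ n → X 1 * V (V (X (tri n))) ≈ X (tri (1 ℕ.+ n ℕ.* 3))
  VV-X n = ≈-sym (≈-trans (X-cong (tri-1mod3 n)) (≈-trans (X-+ 1 _)
    (*-congˡ (X 1) (≈-sym (≈-trans (V-cong (V-X (tri n))) (V-X (tri n ℕ.* 3)))))))

  triSum-partial : ∀ N → triSum (1 ℕ.+ N ℕ.* 3) ≈ V (Π.θ N) + X 1 * V (V (triSum N))
  triSum-partial zero = +-cong (≈-trans X-0 (≈-sym V-1)) (≈-sym (VV-X 0))
  triSum-partial (suc N) = begin
    triSum (1 ℕ.+ N ℕ.* 3) + X (tri (2 ℕ.+ N ℕ.* 3)) + X (tri (suc N ℕ.* 3)) + X (tri (1 ℕ.+ suc N ℕ.* 3))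
      ≈⟨ +-cong (+-cong (+-cong (triSum-partial N) (X-cong (tri-2mod3 N))) (X-cong (tri-0mod3 (suc N)))) (≈-sym (VV-X (suc N))) ⟩
    V (Π.θ N) + X 1 * V (V (triSum N)) + X (exponent 1 3 (suc N) ℕ.* 3) + X (exponent 2 3 (suc N) ℕ.* 3) + X 1 * V (V c)
      ≈⟨ +-cong (+-cong (+-cong ≈-refl (≈-sym (≈-trans (V-cong (Π-term₁ (suc N))) (V-X _))))
           (≈-sym (≈-trans (V-cong (Π-term₂ (suc N))) (V-X _)))) ≈-refl ⟩
    V (Π.θ N) + X 1 * V (V (triSum N)) + V a + V b + X 1 * V (V c)
      ≈⟨ solve 6 (λ q p t a b c → p :+ q :* t :+ a :+ b :+ q :* c := p :+ (a :+ b) :+ q :* (t :+ c)) ≈-refl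
           (X 1) (V (Π.θ N)) (V (V (triSum N))) (V a) (V b) (V (V c)) ⟩
    V (Π.θ N) + (V a + V b) + X 1 * (V (V (triSum N)) + V (V c))
      ≈⟨ +-cong (≈-trans (V-+ _ _) (+-cong ≈-refl (V-+ _ _))) (*-congˡ (X 1) (≈-trans (V-cong (V-+ _ _)) (V-+ _ _))) ⟨
    V (Π.θ (suc N)) + X 1 * V (V (triSum (suc N)))
      ∎
    where
    a = Π.term (X 1) (suc N)
    b = Π.term (X 2) (suc N)
    c = X (tri (suc N))

Ψ-dissection : Ψ ≈ V Π∞ + X 1 * V (V Ψ)
Ψ-dissection = tends-unique
  (tends-subsequence (ℕ._* 3) (λ N → ℕ.m≤m*n N 3) tends-triSum-odd)
  (tends-+ (tends-V (tends-subsequence (ℕ._* 2) (λ N → ℕ.m≤m*n N 2) tends-Π))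
    (tends-* (tends-constant (X 1)) (tends-V (tends-V tends-triSum-even))))
  (λ N → ≈-trans (≈-reflexive (cong (λ M → triSum (suc M)) (swap N))) (triSum-partial (N ℕ.* 2)))
  where
  swap : ∀ N → N ℕ.* 3 ℕ.* 2 ≡ N ℕ.* 2 ℕ.* 3
  swap = solve-∀

-- The 3-dissection of E = f₁f₂

E : Series
E = G⁻ 1 1 * G⁻ 2 2

-- Classically φ(-q) = f₁²/f₂ and ψ(q) = f₂²/f₁. Here quotients are avoided: splitting one (q; q²)∞
-- modulo 4 pairs its halves with the `G⁺` factors of Ψ.
Φ*Ψ : Φ * Ψ ≈ E
Φ*Ψ = begin
  G⁻ 2 2 * (G⁻ 1 2 * G⁻ 1 2) * (G⁻ 4 4 * (G⁺ 1 4 * G⁺ 3 4))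
    ≈⟨ *-congʳ Ψ (*-congˡ (G⁻ 2 2) (*-congˡ (G⁻ 1 2) (G⁻-even-odd 1 2))) ⟩
  G⁻ 2 2 * (G⁻ 1 2 * (G⁻ 1 4 * G⁻ 3 4)) * (G⁻ 4 4 * (G⁺ 1 4 * G⁺ 3 4))
    ≈⟨ solve 7 (λ a b c d e g h → a :* (b :* (c :* d)) :* (e :* (g :* h)) := b :* a :* (c :* g :* (d :* h) :* e)) ≈-refl
         (G⁻ 2 2) (G⁻ 1 2) (G⁻ 1 4) (G⁻ 3 4) (G⁻ 4 4) (G⁺ 1 4) (G⁺ 3 4) ⟩
  G⁻ 1 2 * G⁻ 2 2 * (G⁻ 1 4 * G⁺ 1 4 * (G⁻ 3 4 * G⁺ 3 4) * G⁻ 4 4)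
    ≈⟨ *-cong (≈-sym (G⁻-even-odd 1 1)) (*-congʳ (G⁻ 4 4) (*-cong (G⁻*G⁺ 1 4) (G⁻*G⁺ 3 4))) ⟩
  G⁻ 1 1 * (G⁻ 2 8 * G⁻ 6 8 * G⁻ 4 4)
    ≈⟨ *-congˡ (G⁻ 1 1) (*-congʳ (G⁻ 4 4) (≈-sym (G⁻-even-odd 2 4))) ⟩
  G⁻ 1 1 * (G⁻ 2 4 * G⁻ 4 4)
    ≈⟨ *-congˡ (G⁻ 1 1) (≈-sym (G⁻-even-odd 2 2)) ⟩
  G⁻ 1 1 * G⁻ 2 2
    ∎

V-E : V E ≈ G⁻ 3 3 * G⁻ 6 6
V-E = ≈-trans (V-* (G⁻ 1 1) (G⁻ 2 2)) (*-cong (V-G⁻ 1) (V-G⁻ 2))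

-- The auxiliary Y completes (q; q⁶)∞ and (q⁵; q⁶)∞ to (q; q³)∞ and (q²; q³)∞. Paired with the `G⁺`
-- factors of Π∞ these become (q²; q⁶)∞ and (q⁴; q⁶)∞, which is Y again, so it cancels.
Ω*Π : Ω∞ * Π∞ ≈ V E
Ω*Π = ≈-trans (*-cancelˡ Y Y₀ (begin
  Y * (Ω∞ * Π∞)
    ≈⟨ solve 8 (λ a b c d e g h i → a :* b :* (c :* (d :* e) :* (g :* (h :* i))) :=
                                     e :* b :* h :* (a :* d :* i) :* (g :* c)) ≈-refl
         (G⁻ 2 6) (G⁻ 4 6) (G⁻ 6 6) (G⁻ 5 6) (G⁻ 1 6) (G⁻ 3 3) (G⁺ 1 3) (G⁺ 2 3) ⟩
  G⁻ 1 6 * G⁻ 4 6 * G⁺ 1 3 * (G⁻ 2 6 * G⁻ 5 6 * G⁺ 2 3) * (G⁻ 3 3 * G⁻ 6 6)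
    ≈⟨ *-congʳ _ (*-cong (pair 1) (pair 2)) ⟩
  Y * (G⁻ 3 3 * G⁻ 6 6)
    ∎)) (≈-sym V-E)
  where
  Y : Series
  Y = G⁻ 2 6 * G⁻ 4 6
  Y₀ : Y 0 ≡ 1ℤ
  Y₀ = trans (*-zero (G⁻ 2 6) (G⁻ 4 6)) (cong₂ _*ᶻ_ (G⁻-zero 1 6) (G⁻-zero 3 6))
  pair : ∀ r → G⁻ r 6 * G⁻ (r ℕ.+ 3) 6 * G⁺ r 3 ≈ G⁻ (r ℕ.* 2) 6
  pair r = ≈-trans (*-congʳ (G⁺ r 3) (≈-sym (G⁻-even-odd r 3))) (G⁻*G⁺ r 3)

-- The coefficient of q is a difference of two products that both reduce to E(q⁹), by `Φ*Ψ` and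
-- `Ω*Π`; this coincidence makes it -E(q⁹). The outer components multiply to a multiple of the same
-- two products.
E-dissection : E ≈ V (V Φ * Π∞) + X 1 * V (- V E) + X 1 * (X 1 * V (- (con (+ 2) * (Ω∞ * V Ψ))))
E-dissection = begin
  E
    ≈⟨ Φ*Ψ ⟨
  Φ * Ψ
    ≈⟨ *-cong Φ-dissection Ψ-dissection ⟩
  (V (V Φ) - con (+ 2) * (X 1 * V Ω∞)) * (V Π∞ + X 1 * V (V Ψ))
    ≈⟨ solve 5 (λ q a w p b →
         (a :- :con (+ 2) :* (q :* w)) :* (p :+ q :* b) :=
         a :* p :+ q :* (a :* b :- :con (+ 2) :* (w :* p)) :+ q :* (q :* :- (:con (+ 2) :* (w :* b)))) ≈-refl
         (X 1) (V (V Φ)) (V Ω∞) (V Π∞) (V (V Ψ)) ⟩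
  V (V Φ) * V Π∞ + X 1 * (V (V Φ) * V (V Ψ) - con (+ 2) * (V Ω∞ * V Π∞)) + X 1 * (X 1 * - (con (+ 2) * (V Ω∞ * V (V Ψ))))
    ≈⟨ +-cong (+-cong (≈-sym (V-* (V Φ) Π∞)) (*-congˡ (X 1) (begin
         V (V Φ) * V (V Ψ) - con (+ 2) * (V Ω∞ * V Π∞)
           ≈⟨ +-cong (≈-trans (≈-sym (V-* (V Φ) (V Ψ))) (V-cong (≈-trans (≈-sym (V-* Φ Ψ)) (V-cong Φ*Ψ))))
                (-‿cong (*-congˡ (con (+ 2)) (≈-trans (≈-sym (V-* Ω∞ Π∞)) (V-cong Ω*Π)))) ⟩
         V (V E) - con (+ 2) * V (V E)
           ≈⟨ solve 1 (λ x → x :- :con (+ 2) :* x := :- x) ≈-refl (V (V E)) ⟩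
         - V (V E)
           ≈⟨ V-neg (V E) ⟨
         V (- V E)
           ∎)))
         (*-congˡ (X 1) (*-congˡ (X 1) (≈-sym (≈-trans (V-neg _)
           (-‿cong (≈-trans (V-* _ _) (*-cong (V-con (+ 2)) (V-* Ω∞ (V Ψ))))))))) ⟩
  V (V Φ * Π∞) + X 1 * V (- V E) + X 1 * (X 1 * V (- (con (+ 2) * (Ω∞ * V Ψ))))
    ∎

U₁-E : U 1 E ≈ - V E
U₁-E = U₁-component E-dissection

U₀-E*U₂-E : U 0 E * U 2 E ≈ - (con (+ 2) * (V E * V E))
U₀-E*U₂-E = begin
  U 0 E * U 2 E
    ≈⟨ *-cong (U₀-component E-dissection) (U₂-component E-dissection) ⟩
  V Φ * Π∞ * - (con (+ 2) * (Ω∞ * V Ψ))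
    ≈⟨ solve 4 (λ a p w b → a :* p :* :- (:con (+ 2) :* (w :* b)) := :- (:con (+ 2) :* (a :* b :* (w :* p)))) ≈-refl
         (V Φ) Π∞ Ω∞ (V Ψ) ⟩
  - (con (+ 2) * (V Φ * V Ψ * (Ω∞ * Π∞)))
    ≈⟨ -‿cong (*-congˡ (con (+ 2)) (*-cong (≈-trans (≈-sym (V-* Φ Ψ)) (V-cong Φ*Ψ)) Ω*Π)) ⟩
  - (con (+ 2) * (V E * V E))
    ∎

-- Divisibility by powers of 3

private
  D DD q F e : Series
  D  = V E
  DD = V D
  q  = X 1
  F  = q * a₉
  e  = inverse E

V-⁴ : ∀ x → V (x * x * (x * x)) ≈ V x * V x * (V x * V x)
V-⁴ x = ≈-trans (V-* (x * x) (x * x)) (*-cong (V-* x x) (V-* x x))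

norm-1 : norm 1# ≈ 1#
norm-1 = ≈-trans
  (circulant-cong (U₀-component p) (U₁-component p) (U₂-component p))
  (solve 1 (λ q → let o = :con 0ℤ ; i = :con 1ℤ in
     i :* i :* i :+ q :* (o :* o :* o) :+ q :* q :* (o :* o :* o) :- :con (+ 3) :* q :* (i :* o :* o) := i) ≈-refl q)
  where
  p : 1# ≈ V 1# + X 1 * V 0# + X 1 * (X 1 * V 0#)
  p = ≈-sym (≈-trans (+-cong (+-cong V-1 (*-congˡ q (V-con 0ℤ))) (*-congˡ q (*-congˡ q (V-con 0ℤ))))
    (solve 1 (λ q → let o = :con 0ℤ ; i = :con 1ℤ in i :+ q :* o :+ q :* (q :* o) := i) ≈-refl q))

norm-E : norm E * D ≈ E * E * (E * E)
norm-E = begin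
  norm (g * h) * V (g * h)
    ≈⟨ *-congˡ (norm (g * h)) (V-* g h) ⟩
  norm (g * h) * (V g * V h)
    ≈⟨ *-assoc _ (V g) (V h) ⟨
  norm (g * h) * V g * V h
    ≈⟨ *-congʳ (V h) (norm-G⁻-* 1 (λ N → N , inj₁ (ℕ.*-identityʳ _)) (λ N → N , inj₂ (ℕ.*-identityʳ _)) h) ⟩
  g * (g * g * g) * norm h * V h
    ≈⟨ *-assoc _ (norm h) (V h) ⟩
  g * (g * g * g) * (norm h * V h)
    ≈⟨ *-congˡ _ (*-congʳ (V h) (norm-cong (≈-sym (*-identityʳ h)))) ⟩
  g * (g * g * g) * (norm (h * 1#) * V h)
    -- Doubling exchanges the classes 1 and 2 modulo 3, hence the swapped injections.
    ≈⟨ *-congˡ _ (norm-G⁻-* 2 (λ N → N ℕ.* 2 , inj₂ (1mod3 N)) (λ N → 1 ℕ.+ N ℕ.* 2 , inj₁ (2mod3 N)) 1#) ⟩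
  g * (g * g * g) * (h * (h * h * h) * norm 1#)
    ≈⟨ *-congˡ _ (*-congˡ _ norm-1) ⟩
  g * (g * g * g) * (h * (h * h * h) * 1#)
    ≈⟨ solve 2 (λ g h → g :* (g :* g :* g) :* (h :* (h :* h :* h) :* :con 1ℤ) := g :* h :* (g :* h) :* (g :* h :* (g :* h)))
         ≈-refl g h ⟩
  E * E * (E * E)
    ∎
  where
  g = G⁻ 1 1
  h = G⁻ 2 2
  1mod3 : ∀ N → suc (N ℕ.* 3) ℕ.* 2 ≡ 2 ℕ.+ N ℕ.* 2 ℕ.* 3
  1mod3 = solve-∀
  2mod3 : ∀ N → suc (suc (N ℕ.* 3)) ℕ.* 2 ≡ 1 ℕ.+ (1 ℕ.+ N ℕ.* 2) ℕ.* 3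
  2mod3 = solve-∀

V-circulant : ∀ x y z → V (circulant x y z) ≈
  V x * V x * V x + X 1 * X 1 * X 1 * (V y * V y * V y) + X 1 * X 1 * X 1 * (X 1 * X 1 * X 1) * (V z * V z * V z)
    - con (+ 3) * (X 1 * X 1 * X 1) * (V x * V y * V z)
V-circulant x y z = ≈-trans (V-+ _ _) (+-cong
  (≈-trans (V-+ _ _) (+-cong
    (≈-trans (V-+ _ _) (+-cong (V-*₃ x x x) (≈-trans (V-* _ _) (*-cong V-q (V-*₃ y y y)))))
    (≈-trans (V-* _ _) (*-cong (≈-trans (V-* q q) (*-cong V-q V-q)) (V-*₃ z z z)))))
  (≈-trans (V-neg _) (-‿cong (≈-trans (V-* _ _)
    (*-cong (≈-trans (V-* _ q) (*-cong (V-con (+ 3)) V-q)) (V-*₃ x y z))))))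
  where
  V-q : V q ≈ q * q * q
  V-q = ≈-trans (V-X 1) (≈-sym (X-cube 1))
  V-*₃ : ∀ a b c → V (a * b * c) ≈ V a * V b * V c
  V-*₃ a b c = ≈-trans (V-* (a * b) c) (*-congʳ (V c) (V-* a b))

-- For E = a - qd + q²c with ac = -2d², the cubic in E on the left is a
-- polynomial in q³, because E + qd = a + q²c and a, c, d are series in q³.
E-cubic : E * E * E + con (+ 3) * (q * DD) * (E * E) + con (+ 9) * (q * DD) * (q * DD) * E ≈ V (norm E)
E-cubic = begin
  E * E * E + con (+ 3) * (q * DD) * (E * E) + con (+ 9) * (q * DD) * (q * DD) * E
    ≈⟨ +-cong (+-cong (*-cong (*-cong E≈ E≈) E≈) (*-congˡ _ (*-cong E≈ E≈))) (*-congˡ _ E≈) ⟩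
  E′ * E′ * E′ + con (+ 3) * (q * DD) * (E′ * E′) + con (+ 9) * (q * DD) * (q * DD) * E′
    -- The cubic minus the norm equals 3q²E(ac + 2d²), which names the multiple of the relation ac =
    -- -2d² to use.
    ≈⟨ by-multiple (con (+ 3) * (q * q) * E′) ac≈
         (solve 4 (λ q a d c →
            let E = a :+ q :* (:- d) :+ q :* (q :* c)
                p = :con (+ 3) :* (q :* q) :* E
                n = :con (+ 3)
                q³ = q :* q :* q in
            E :* E :* E :+ n :* (q :* d) :* (E :* E) :+ :con (+ 9) :* (q :* d) :* (q :* d) :* E
              :+ p :* (:- (:con (+ 2) :* (d :* d))) :=
            a :* a :* a :+ q³ :* (:- d :* :- d :* :- d) :+ q³ :* q³ :* (c :* c :* c) :- n :* q³ :* (a :* :- d :* c)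
              :+ p :* (a :* c)) ≈-refl q (V (U 0 E)) DD (V (U 2 E))) ⟩
  a * a * a + q³ * (- DD * - DD * - DD) + q³ * q³ * (c * c * c) - con (+ 3) * q³ * (a * - DD * c)
    ≈⟨ +-cong (+-cong (+-cong ≈-refl (*-congˡ q³ (*-cong (*-cong b≈ b≈) b≈))) ≈-refl)
         (-‿cong (*-congˡ _ (*-congʳ c (*-congˡ a b≈)))) ⟨
  a * a * a + q³ * (V (U 1 E) * V (U 1 E) * V (U 1 E)) + q³ * q³ * (c * c * c) - con (+ 3) * q³ * (a * V (U 1 E) * c)
    ≈⟨ V-circulant (U 0 E) (U 1 E) (U 2 E) ⟨
  V (norm E)
    ∎
  where
  a = V (U 0 E)
  c = V (U 2 E)
  q³ = q * q * q
  E′ = a + q * - DD + q * (q * c)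
  b≈ : V (U 1 E) ≈ - DD
  b≈ = ≈-trans (V-cong U₁-E) (V-neg D)
  E≈ : E ≈ E′
  E≈ = ≈-trans (dissection E) (+-cong (+-cong ≈-refl (*-congˡ q b≈)) ≈-refl)
  ac≈ : a * c ≈ - (con (+ 2) * (DD * DD))
  ac≈ = ≈-trans (≈-sym (V-* _ _)) (≈-trans (V-cong U₀-E*U₂-E) (≈-trans (V-neg _)
    (-‿cong (≈-trans (V-* _ _) (*-cong (V-con (+ 2)) (V-* D D))))))

E₀ : E 0 ≡ 1ℤ
E₀ = trans (*-zero (G⁻ 1 1) (G⁻ 2 2)) (cong₂ _*ᶻ_ (G⁻-zero 0 1) (G⁻-zero 1 2))

eE≈1 : e * E ≈ 1#
eE≈1 = inverse-correct E E₀

a₉*E : a₉ * E ≈ DD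
a₉*E = begin
  a₉ * (G⁻ 1 1 * G⁻ 2 2)
    ≈⟨ *-congˡ a₉ (*-cong (f≈G⁻ 1) (f≈G⁻ 2)) ⟨
  a₉ * (f 1 * f 2)
    ≈⟨ pointwise (λ n → trans (at (*-congˡ a₉ (pointwise (*-⊛ (f 1) (f 2)))) n)
         (trans (*-⊛ a₉ (f 1 ⊛ f 2) n) (trans (a₉-generating n) (sym (*-⊛ (f 9) (f 18) n))))) ⟩
  f 9 * f 18
    ≈⟨ *-cong (f≈G⁻ 9) (f≈G⁻ 18) ⟩
  G⁻ 9 9 * G⁻ 18 18
    ≈⟨ *-cong (V-G⁻ 3) (V-G⁻ 6) ⟨
  V (G⁻ 3 3) * V (G⁻ 6 6)
    ≈⟨ ≈-trans (V-cong V-E) (V-* (G⁻ 3 3) (G⁻ 6 6)) ⟨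
  DD
    ∎

-- The algebraic relations between F, y and y(q³)

private
  FE : F * E ≈ q * DD
  FE = ≈-trans (*-assoc q a₉ E) (*-congˡ q a₉*E)

  K y z G : Series
  K = 1# + con (+ 3) * F + con (+ 9) * (F * F)
  y = q * (D * D * (D * D)) * (e * e * (e * e))
  z = con (+ 3) * y
  G = con (+ 3) * F

  -- Dividing the cubic of `E-cubic` by E³ turns qE(q⁹)/E into F and leaves K; `norm-E` at q³
  -- evaluates the other side. Both y = F K and F³ = y(q³) K are rearrangements of this identity.
  E³K : E * E * E * K * DD ≈ D * D * (D * D)
  E³K = begin
    E * E * E * K * DD
      ≈⟨ *-congʳ DD (solve 2 (λ e f → e :* e :* e :* (:con 1ℤ :+ :con (+ 3) :* f :+ :con (+ 9) :* (f :* f)) :=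
           e :* e :* e :+ :con (+ 3) :* (f :* e) :* (e :* e) :+ :con (+ 9) :* (f :* e) :* (f :* e) :* e) ≈-refl E F) ⟩
    (E * E * E + con (+ 3) * (F * E) * (E * E) + con (+ 9) * (F * E) * (F * E) * E) * DD
      ≈⟨ *-congʳ DD (+-cong (+-cong ≈-refl (*-congʳ _ (*-congˡ _ FE))) (*-congʳ E (*-cong (*-congˡ _ FE) FE))) ⟩
    (E * E * E + con (+ 3) * (q * DD) * (E * E) + con (+ 9) * (q * DD) * (q * DD) * E) * DD
      ≈⟨ *-congʳ DD E-cubic ⟩
    V (norm E) * V D
      ≈⟨ V-* (norm E) D ⟨
    V (norm E * D)
      ≈⟨ V-cong norm-E ⟩
    V (E * E * (E * E))
      ≈⟨ V-⁴ E ⟩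
    D * D * (D * D)
      ∎

  fourth-power : ∀ {u} → u ≈ 1# → u * u * (u * u) ≈ 1#
  fourth-power p = ≈-trans (*-cong (*-cong p p) (*-cong p p))
    (solve 0 (let i = :con 1ℤ in i :* i :* (i :* i) := i) ≈-refl)

  y≈FK : y ≈ F * K
  y≈FK = begin
    q * (D * D * (D * D)) * (e * e * (e * e))
      ≈⟨ *-congʳ _ (*-congˡ q (≈-sym E³K)) ⟩
    q * (E * E * E * K * DD) * (e * e * (e * e))
      ≈⟨ solve 5 (λ q x k d e → q :* (x :* x :* x :* k :* d) :* (e :* e :* (e :* e)) :=
           q :* d :* e :* (x :* x :* x :* k :* (e :* e :* e))) ≈-refl q E K DD e ⟩
    q * DD * e * (E * E * E * K * (e * e * e))
      ≈⟨ *-congʳ _ (*-congʳ e (≈-sym FE)) ⟩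
    F * E * e * (E * E * E * K * (e * e * e))
      ≈⟨ solve 4 (λ f x k e → f :* x :* e :* (x :* x :* x :* k :* (e :* e :* e)) :=
           f :* k :* (e :* x :* (e :* x) :* (e :* x :* (e :* x)))) ≈-refl F E K e ⟩
    F * K * (e * E * (e * E) * (e * E * (e * E)))
      ≈⟨ *-congˡ (F * K) (fourth-power eE≈1) ⟩
    F * K * 1#
      ≈⟨ *-identityʳ (F * K) ⟩
    F * K
      ∎

  F³ : F * F * F ≈ V y * K
  F³ = begin
    F * F * F
      ≈⟨ *-identityʳ _ ⟨
    F * F * F * 1#
      ≈⟨ *-congˡ _ (fourth-power Ve*D) ⟨
    F * F * F * (v * D * (v * D) * (v * D * (v * D)))
      ≈⟨ solve 3 (λ f v d → f :* f :* f :* (v :* d :* (v :* d) :* (v :* d :* (v :* d))) :=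
           f :* f :* f :* (v :* v :* (v :* v)) :* (d :* d :* (d :* d))) ≈-refl F v D ⟩
    F * F * F * (v * v * (v * v)) * (D * D * (D * D))
      ≈⟨ *-congˡ _ (≈-sym E³K) ⟩
    F * F * F * (v * v * (v * v)) * (E * E * E * K * DD)
      ≈⟨ solve 5 (λ f v x k d → f :* f :* f :* (v :* v :* (v :* v)) :* (x :* x :* x :* k :* d) :=
           f :* x :* (f :* x) :* (f :* x) :* (d :* (v :* v :* (v :* v)) :* k)) ≈-refl F v E K DD ⟩
    F * E * (F * E) * (F * E) * (DD * (v * v * (v * v)) * K)
      ≈⟨ *-congʳ _ (*-cong (*-cong FE FE) FE) ⟩
    q * DD * (q * DD) * (q * DD) * (DD * (v * v * (v * v)) * K)
      ≈⟨ solve 4 (λ q d v k → q :* d :* (q :* d) :* (q :* d) :* (d :* (v :* v :* (v :* v)) :* k) :=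
           q :* q :* q :* (d :* d :* (d :* d)) :* (v :* v :* (v :* v)) :* k) ≈-refl q DD v K ⟩
    q * q * q * (DD * DD * (DD * DD)) * (v * v * (v * v)) * K
      ≈⟨ *-congʳ K (*-cong (*-cong (X-cube 1) (≈-sym (V-⁴ D))) (≈-sym (V-⁴ e))) ⟩
    X 3 * V (D * D * (D * D)) * V (e * e * (e * e)) * K
      ≈⟨ *-congʳ K (≈-trans (V-* _ _) (*-congʳ _ (≈-trans (V-* _ _) (*-congʳ _ (V-X 1))))) ⟨
    V y * K
      ∎
    where
    v : Series
    v = V e
    Ve*D : v * D ≈ 1#
    Ve*D = ≈-trans (≈-sym (V-* e E)) (≈-trans (V-cong eE≈1) V-1)

  -- The values of U on F and F²

  U₂-E² : U 2 (E * E) ≈ - (con (+ 3) * (D * D))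
  U₂-E² = begin
    U 2 (E * E)
      ≈⟨ U-cong 2 (≈-trans (*-congʳ E (dissection E))
           (solve 5 (λ q a b c x → (a :+ q :* b :+ q :* (q :* c)) :* x := a :* x :+ q :* (b :* x) :+ q :* (q :* (c :* x)))
             ≈-refl q (V a) (V b) (V c) E)) ⟩
    U 2 (V a * E + q * (V b * E) + q * (q * (V c * E)))
      ≈⟨ ≈-trans (U-+ 2 _ _) (+-cong (≈-trans (U-+ 2 _ _) (+-cong (U₂-V-* a E)
           (≈-trans (U₂-X _) (U₁-V-* b E)))) (≈-trans (U₂-X _) (≈-trans (U₁-X _) (U₀-V-* c E)))) ⟩
    a * c + b * b + c * a
      ≈⟨ +-cong (+-cong U₀-E*U₂-E (*-cong U₁-E U₁-E)) (≈-trans (*-comm c a) U₀-E*U₂-E) ⟩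
    - (con (+ 2) * (D * D)) + - D * - D + - (con (+ 2) * (D * D))
      ≈⟨ solve 1 (λ d → :- (:con (+ 2) :* (d :* d)) :+ :- d :* :- d :+ :- (:con (+ 2) :* (d :* d)) :=
           :- (:con (+ 3) :* (d :* d))) ≈-refl D ⟩
    - (con (+ 3) * (D * D))
      ∎
    where
    a = U 0 E
    b = U 1 E
    c = U 2 E

  U₀-con : ∀ k a → U 0 (con k * a) ≈ con k * U 0 a
  U₀-con k a = ≈-trans (U-cong 0 (*-congʳ a (≈-sym (V-con k)))) (U₀-V-* (con k) a)

  U₀-qqq : ∀ a b → U 0 (q * (q * (q * (V a * b)))) ≈ q * (a * U 0 b)
  U₀-qqq a b = ≈-trans (U₀-X _) (*-congˡ q (≈-trans (U₂-X _) (≈-trans (U₁-X _) (U₀-V-* a b))))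

  U₀-qqE : ∀ a → U 0 (q * (q * (V a * E))) ≈ q * (a * - D)
  U₀-qqE a = ≈-trans (U₀-X _) (*-congˡ q (≈-trans (U₂-X _) (≈-trans (U₁-V-* a E) (*-congˡ a U₁-E))))

  -- `U` can be evaluated after clearing denominators by a series in q³. The choice D⁴ works because
  -- `E³K` exhibits the factor E³ in it, which turns factors F into qE(q⁹).
  divide-E⁴ : ∀ {x w} → V (E * E * (E * E)) * x ≈ w → U 0 x ≈ U 0 w * (e * e * (e * e))
  divide-E⁴ {x} {w} p = begin
    U 0 x
      ≈⟨ ≈-trans (*-congʳ (U 0 x) (fourth-power eE≈1)) (*-identityˡ (U 0 x)) ⟨
    e * E * (e * E) * (e * E * (e * E)) * U 0 x
      ≈⟨ solve 3 (λ e x u → e :* x :* (e :* x) :* (e :* x :* (e :* x)) :* u :=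
           x :* x :* (x :* x) :* u :* (e :* e :* (e :* e))) ≈-refl e E (U 0 x) ⟩
    E * E * (E * E) * U 0 x * (e * e * (e * e))
      ≈⟨ *-congʳ _ (≈-trans (≈-sym (U₀-V-* _ x)) (U-cong 0 p)) ⟩
    U 0 w * (e * e * (e * e))
      ∎

  VE⁴ : V (E * E * (E * E)) ≈ E * E * E * K * DD
  VE⁴ = ≈-trans (V-⁴ E) (≈-sym E³K)

  U-F : U 0 F ≈ z
  U-F = begin
    U 0 F
      ≈⟨ divide-E⁴ (begin
           V (E * E * (E * E)) * F
             ≈⟨ *-congʳ F VE⁴ ⟩
           E * E * E * K * DD * F
             ≈⟨ solve 3 (λ x f d → x :* x :* x :* (:con 1ℤ :+ :con (+ 3) :* f :+ :con (+ 9) :* (f :* f)) :* d :* f :=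
                  d :* (x :* x :* (f :* x) :+ :con (+ 3) :* (f :* x :* (f :* x) :* x)
                         :+ :con (+ 9) :* (f :* x :* (f :* x) :* (f :* x)))) ≈-refl E F DD ⟩
           DD * (E * E * (F * E) + con (+ 3) * (F * E * (F * E) * E) + con (+ 9) * (F * E * (F * E) * (F * E)))
             ≈⟨ *-congˡ DD (+-cong (+-cong (*-congˡ _ FE) (*-congˡ _ (*-congʳ E (*-cong FE FE))))
                  (*-congˡ _ (*-cong (*-cong FE FE) FE))) ⟩
           DD * (E * E * (q * DD) + con (+ 3) * (q * DD * (q * DD) * E) + con (+ 9) * (q * DD * (q * DD) * (q * DD)))
             ≈⟨ solve 3 (λ q d x →
                  d :* (x :* x :* (q :* d) :+ :con (+ 3) :* (q :* d :* (q :* d) :* x) :+ :con (+ 9) :* (q :* d :* (q :* d) :* (q :* d))) :=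
                  d :* d :* (q :* (x :* x) :+ :con (+ 3) :* (q :* (q :* (d :* x))) :+ :con (+ 9) :* (q :* (q :* (q :* (d :* d))))))
                  ≈-refl q DD E ⟩
           DD * DD * (q * (E * E) + con (+ 3) * (q * (q * (DD * E))) + con (+ 9) * (q * (q * (q * (DD * DD)))))
             ∎) ⟩
    U 0 (DD * DD * w) * e⁴
      ≈⟨ *-congʳ e⁴ (≈-trans (U-cong 0 (*-congʳ w (≈-sym (V-* D D)))) (U₀-V-* (D * D) w)) ⟩
    D * D * U 0 w * e⁴
      ≈⟨ *-congʳ e⁴ (*-congˡ (D * D) (≈-trans (U-+ 0 _ _) (+-cong (≈-trans (U-+ 0 _ _) (+-cong
           (≈-trans (U₀-X _) (*-congˡ q U₂-E²))
           (≈-trans (U₀-con (+ 3) _) (*-congˡ _ (U₀-qqE D)))))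
           (≈-trans (U₀-con (+ 9) _) (*-congˡ _ (≈-trans (U₀-qqq D DD) (*-congˡ q (*-congˡ D (U₀-V D))))))))) ⟩
    -- The coefficients -3, -3 and 9 add up to 3, the factor in U F = 3y.
    D * D * (q * - (con (+ 3) * (D * D)) + con (+ 3) * (q * (D * - D)) + con (+ 9) * (q * (D * D))) * e⁴
      ≈⟨ solve 3 (λ q d e → d :* d :* (q :* :- (:con (+ 3) :* (d :* d)) :+ :con (+ 3) :* (q :* (d :* :- d))
                              :+ :con (+ 9) :* (q :* (d :* d))) :* e :=
           :con (+ 3) :* (q :* (d :* d :* (d :* d)) :* e)) ≈-refl q D e⁴ ⟩
    z
      ∎
    where
    w = q * (E * E) + con (+ 3) * (q * (q * (DD * E))) + con (+ 9) * (q * (q * (q * (DD * DD))))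
    e⁴ = e * e * (e * e)

  U-F² : U 0 (F * F) ≈ con (+ 2) * y + con (+ 27) * (y * y)
  U-F² = begin
    U 0 (F * F)
      ≈⟨ divide-E⁴ (begin
           V (E * E * (E * E)) * (F * F)
             ≈⟨ *-congʳ (F * F) VE⁴ ⟩
           E * E * E * K * DD * (F * F)
             ≈⟨ solve 3 (λ x f d → x :* x :* x :* (:con 1ℤ :+ :con (+ 3) :* f :+ :con (+ 9) :* (f :* f)) :* d :* (f :* f) :=
                  d :* (f :* x :* (f :* x) :* x :+ :con (+ 3) :* (f :* x :* (f :* x) :* (f :* x))
                         :+ :con (+ 9) :* (f :* x :* (f :* x) :* (f :* x) :* f))) ≈-refl E F DD ⟩
           -- The top term has F⁴ against only E³, so one F survives; its image under `U` is
           -- supplied by `U-F` and yields the y² term.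
           DD * (F * E * (F * E) * E + con (+ 3) * (F * E * (F * E) * (F * E)) + con (+ 9) * (F * E * (F * E) * (F * E) * F))
             ≈⟨ *-congˡ DD (+-cong (+-cong (*-congʳ E (*-cong FE FE)) (*-congˡ _ (*-cong (*-cong FE FE) FE)))
                  (*-congˡ _ (*-congʳ F (*-cong (*-cong FE FE) FE)))) ⟩
           DD * (q * DD * (q * DD) * E + con (+ 3) * (q * DD * (q * DD) * (q * DD)) + con (+ 9) * (q * DD * (q * DD) * (q * DD) * F))
             ≈⟨ solve 4 (λ q d x f →
                  d :* (q :* d :* (q :* d) :* x :+ :con (+ 3) :* (q :* d :* (q :* d) :* (q :* d))
                    :+ :con (+ 9) :* (q :* d :* (q :* d) :* (q :* d) :* f)) :=
                  d :* d :* (q :* (q :* (d :* x)) :+ :con (+ 3) :* (q :* (q :* (q :* (d :* d))))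
                    :+ :con (+ 9) :* (q :* (q :* (q :* (d :* (d :* f)))))))
                  ≈-refl q DD E F ⟩
           DD * DD * (q * (q * (DD * E)) + con (+ 3) * (q * (q * (q * (DD * DD)))) + con (+ 9) * (q * (q * (q * (DD * (DD * F))))))
             ∎) ⟩
    U 0 (DD * DD * w) * e⁴
      ≈⟨ *-congʳ e⁴ (≈-trans (U-cong 0 (*-congʳ w (≈-sym (V-* D D)))) (U₀-V-* (D * D) w)) ⟩
    D * D * U 0 w * e⁴
      ≈⟨ *-congʳ e⁴ (*-congˡ (D * D) (≈-trans (U-+ 0 _ _) (+-cong (≈-trans (U-+ 0 _ _) (+-cong
           (U₀-qqE D)
           (≈-trans (U₀-con (+ 3) _) (*-congˡ _ (≈-trans (U₀-qqq D DD) (*-congˡ q (*-congˡ D (U₀-V D))))))))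
           (≈-trans (U₀-con (+ 9) _) (*-congˡ _ (≈-trans (U₀-qqq D (DD * F)) (*-congˡ q (*-congˡ D
             (≈-trans (U₀-V-* D F) (*-congˡ D U-F)))))))))) ⟩
    D * D * (q * (D * - D) + con (+ 3) * (q * (D * D)) + con (+ 9) * (q * (D * (D * (con (+ 3) * y))))) * e⁴
      ≈⟨ solve 4 (λ q d e y → d :* d :* (q :* (d :* :- d) :+ :con (+ 3) :* (q :* (d :* d))
                              :+ :con (+ 9) :* (q :* (d :* (d :* (:con (+ 3) :* y))))) :* e :=
           :con (+ 2) :* (q :* (d :* d :* (d :* d)) :* e) :+ :con (+ 27) :* (q :* (d :* d :* (d :* d)) :* e :* y)) ≈-refl q D e⁴ y ⟩
    con (+ 2) * y + con (+ 27) * (y * y)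
      ∎
    where
    w = q * (q * (DD * E)) + con (+ 3) * (q * (q * (q * (DD * DD)))) + con (+ 9) * (q * (q * (q * (DD * (DD * F)))))
    e⁴ = e * e * (e * e)

  z≈ : z ≈ G + G * G + G * (G * G)
  z≈ = ≈-trans (*-congˡ _ y≈FK)
    (solve 1 (λ f → let n = :con (+ 3) in
       n :* (f :* (:con 1ℤ :+ n :* f :+ :con (+ 9) :* (f :* f))) :=
       n :* f :+ n :* f :* (n :* f) :+ n :* f :* (n :* f :* (n :* f))) ≈-refl F)

  G³ : G * (G * G) ≈ con (+ 9) * (V z * (1# + G + G * G))
  G³ = begin
    G * (G * G)
      ≈⟨ solve 1 (λ f → let n = :con (+ 3) in n :* f :* (n :* f :* (n :* f)) := :con (+ 27) :* (f :* f :* f)) ≈-refl F ⟩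
    con (+ 27) * (F * F * F)
      ≈⟨ *-congˡ _ F³ ⟩
    con (+ 27) * (V y * K)
      ≈⟨ solve 2 (λ f v → let n = :con (+ 3) ; i = :con 1ℤ in
           :con (+ 27) :* (v :* (i :+ n :* f :+ :con (+ 9) :* (f :* f))) :=
           :con (+ 9) :* (n :* v :* (i :+ n :* f :+ n :* f :* (n :* f)))) ≈-refl F (V y) ⟩
    con (+ 9) * (con (+ 3) * V y * (1# + G + G * G))
      ≈⟨ *-congˡ _ (*-congʳ _ (≈-trans (V-* _ y) (*-congʳ (V y) (V-con (+ 3))))) ⟨
    con (+ 9) * (V z * (1# + G + G * G))
      ∎

-- Polynomials in G and z under U

-- g ℕ[g]
data Span (g : Series) : Series → Set where
  generator : Span g g
  add       : ∀ {x w} → Span g x → Span g w → Span g (x + w)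
  multiply  : ∀ {x} → Span g x → Span g (g * x)
  respects  : ∀ {x w} → x ≈ w → Span g x → Span g w

triple : ∀ {g x} → Span g x → Span g (con (+ 3) * x)
triple {x = x} p = respects (solve 1 (λ x → x :+ x :+ x := :con (+ 3) :* x) ≈-refl x) (add (add p p) p)

-- The cofactor is kept inside the span of z, not merely in ℤ[[q]], so that `U` can be applied to it
-- again.
Threefold : Series → Set
Threefold x = ∃ λ m → Span z m × x ≈ con (+ 3) * m

threefold-+ : ∀ {x w} → Threefold x → Threefold w → Threefold (x + w)
threefold-+ (m , p , x≈) (m′ , p′ , w≈) = m + m′ , add p p′ ,
  ≈-trans (+-cong x≈ w≈) (solve 2 (λ m m′ → let n = :con (+ 3) in n :* m :+ n :* m′ := n :* (m :+ m′)) ≈-refl m m′)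

threefold-respects : ∀ {x w} → x ≈ w → Threefold x → Threefold w
threefold-respects x≈w (m , p , x≈) = m , p , ≈-trans (≈-sym x≈w) x≈

threefold-9z : ∀ {x} → Threefold x → Threefold (con (+ 9) * (z * x))
threefold-9z (m , p , x≈) = con (+ 3) * (con (+ 3) * (z * m)) , triple (triple (multiply p)) ,
  ≈-trans (*-congˡ _ (*-congˡ z x≈))
    (solve 2 (λ z m → let n = :con (+ 3) in :con (+ 9) :* (z :* (n :* m)) := n :* (n :* (n :* (z :* m)))) ≈-refl z m)

span-z⇒span-G : ∀ {x} → Span z x → Span G x
span-z⇒span-G generator = respects (≈-sym z≈) (add (add generator (multiply generator)) (multiply (multiply generator)))
span-z⇒span-G (add p r) = add (span-z⇒span-G p) (span-z⇒span-G r)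
span-z⇒span-G (multiply {x} p) = respects
  (≈-trans (solve 2 (λ g x → g :* x :+ g :* (g :* x) :+ g :* (g :* (g :* x)) := (g :+ g :* g :+ g :* (g :* g)) :* x) ≈-refl G x)
    (*-congʳ x (≈-sym z≈)))
  (add (add (multiply p′) (multiply (multiply p′))) (multiply (multiply (multiply p′))))
  where p′ = span-z⇒span-G p
span-z⇒span-G (respects eq p) = respects eq (span-z⇒span-G p)

-- The relation for G³ has coefficients in ℤ[[q³]], so `U` turns its z(q³) into z: a recurrence of
-- order three for U(Gⁿx).
threefold-U-G³ : ∀ {x} → U 0 (G * (G * (G * x))) ≈ con (+ 9) * (z * (U 0 x + U 0 (G * x) + U 0 (G * (G * x))))
threefold-U-G³ {x} = begin
  U 0 (G * (G * (G * x)))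
    ≈⟨ U-cong 0 (≈-trans (solve 2 (λ g x → g :* (g :* (g :* x)) := g :* (g :* g) :* x) ≈-refl G x)
         (≈-trans (*-congʳ x G³) (solve 3 (λ z g x →
           :con (+ 9) :* (z :* (:con 1ℤ :+ g :+ g :* g)) :* x := :con (+ 9) :* (z :* (x :+ g :* x :+ g :* (g :* x))))
           ≈-refl (V z) G x))) ⟩
  U 0 (con (+ 9) * (V z * (x + G * x + G * (G * x))))
    ≈⟨ ≈-trans (U₀-con (+ 9) _) (*-congˡ _ (≈-trans (U₀-V-* z _) (*-congˡ z
         (≈-trans (U-+ 0 _ _) (+-cong (U-+ 0 _ _) ≈-refl))))) ⟩
  con (+ 9) * (z * (U 0 x + U 0 (G * x) + U 0 (G * (G * x))))
    ∎

U-G : Threefold (U 0 G)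
U-G = z , generator , ≈-trans (U₀-con (+ 3) F) (*-congˡ _ U-F)

-- Here the rescaling by 3 pays off: 9 · 2y = 3 · 2z and 9 · 27y² = 3 · 9z², which is the witness.
U-G² : Threefold (U 0 (G * G))
U-G² = z + z + con (+ 3) * (con (+ 3) * (z * z)) , add (add generator generator) (triple (triple (multiply generator))) , (begin
  U 0 (G * G)
    ≈⟨ ≈-trans (U-cong 0 (solve 1 (λ f → let n = :con (+ 3) in n :* f :* (n :* f) := :con (+ 9) :* (f :* f)) ≈-refl F))
         (U₀-con (+ 9) (F * F)) ⟩
  con (+ 9) * U 0 (F * F)
    ≈⟨ *-congˡ _ U-F² ⟩
  con (+ 9) * (con (+ 2) * y + con (+ 27) * (y * y))
    ≈⟨ solve 1 (λ y → let n = :con (+ 3) ; z = n :* y in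
         :con (+ 9) :* (:con (+ 2) :* y :+ :con (+ 27) :* (y :* y)) :=
         n :* (z :+ z :+ n :* (n :* (z :* z)))) ≈-refl y ⟩
  con (+ 3) * (z + z + con (+ 3) * (con (+ 3) * (z * z)))
    ∎)

-- The recurrence at x = 1 needs separate treatment, because U 1 = 1 has a constant term and is not
-- in the span; its contribution 9z is still 3 · 3z.
U-G³ : Threefold (U 0 (G * (G * G)))
U-G³ = threefold-respects
  (begin
    con (+ 9) * z + con (+ 9) * (z * (U 0 G + U 0 (G * G)))
      ≈⟨ solve 2 (λ z u → :con (+ 9) :* z :+ :con (+ 9) :* (z :* u) := :con (+ 9) :* (z :* (:con 1ℤ :+ u)))
           ≈-refl z (U 0 G + U 0 (G * G)) ⟩
    con (+ 9) * (z * (1# + (U 0 G + U 0 (G * G))))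
      ≈⟨ *-congˡ _ (*-congˡ z (solve 2 (λ a b → :con 1ℤ :+ (a :+ b) := :con 1ℤ :+ a :+ b) ≈-refl (U 0 G) (U 0 (G * G)))) ⟩
    con (+ 9) * (z * (1# + U 0 G + U 0 (G * G)))
      ≈⟨ *-congˡ _ (*-congˡ z (+-cong (+-cong (≈-trans (U-cong 0 (≈-sym V-1)) (U₀-V 1#)) (U-cong 0 (*-identityʳ G)))
           (U-cong 0 (*-congˡ G (*-identityʳ G))))) ⟨
    con (+ 9) * (z * (U 0 1# + U 0 (G * 1#) + U 0 (G * (G * 1#))))
      ≈⟨ threefold-U-G³ ⟨
    U 0 (G * (G * (G * 1#)))
      ≈⟨ U-cong 0 (*-congˡ G (*-congˡ G (*-identityʳ G))) ⟩
    U 0 (G * (G * G))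
      ∎)
  (threefold-+ (con (+ 3) * z , triple generator , solve 1 (λ z → let n = :con (+ 3) in :con (+ 9) :* z := n :* (n :* z)) ≈-refl z)
    (threefold-9z (threefold-+ U-G U-G²)))

-- Since the recurrence has order three, the induction carries a window of three consecutive
-- multiples x, Gx, G²x, which `multiply` shifts by one.
U-span-G : ∀ {x} → Span G x → Threefold (U 0 x) × Threefold (U 0 (G * x)) × Threefold (U 0 (G * (G * x)))
U-span-G generator = U-G , U-G² , U-G³
U-span-G (add {x} {w} p r) =
  let p₀ , p₁ , p₂ = U-span-G p
      r₀ , r₁ , r₂ = U-span-G r
  in threefold-respects (≈-sym (U-+ 0 x w)) (threefold-+ p₀ r₀)
   , threefold-respects (≈-sym (≈-trans (U-cong 0 (distrib G x w)) (U-+ 0 _ _))) (threefold-+ p₁ r₁)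
   , threefold-respects (≈-sym (≈-trans (U-cong 0 (≈-trans (*-congˡ G (distrib G x w)) (distrib G _ _))) (U-+ 0 _ _)))
       (threefold-+ p₂ r₂)
  where
  distrib : ∀ g x w → g * (x + w) ≈ g * x + g * w
  distrib = solve 3 (λ g x w → g :* (x :+ w) := g :* x :+ g :* w) ≈-refl
U-span-G (multiply p) =
  let p₀ , p₁ , p₂ = U-span-G p
  in p₁ , p₂ , threefold-respects (≈-sym threefold-U-G³) (threefold-9z (threefold-+ (threefold-+ p₀ p₁) p₂))
U-span-G (respects eq p) =
  let p₀ , p₁ , p₂ = U-span-G p
  in threefold-respects (U-cong 0 eq) p₀
   , threefold-respects (U-cong 0 (*-congˡ G eq)) p₁
   , threefold-respects (U-cong 0 (*-congˡ G (*-congˡ G eq))) p₂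

span-z-divisible : ∀ {x} → Span z x → ∃ λ w → x ≈ con (+ 3) * w
span-z-divisible generator = y , ≈-refl
span-z-divisible (add p r) =
  let w , p′ = span-z-divisible p
      w′ , r′ = span-z-divisible r
  in w + w′ , ≈-trans (+-cong p′ r′)
       (solve 2 (λ w w′ → let n = :con (+ 3) in n :* w :+ n :* w′ := n :* (w :+ w′)) ≈-refl w w′)
span-z-divisible (multiply {x} p) = y * x , *-assoc (con (+ 3)) y x
span-z-divisible (respects eq p) = let w , p′ = span-z-divisible p in w , ≈-trans (≈-sym eq) p′

3^suc : ∀ k → + (3 ℕ.^ suc k) ≡ + (3 ℕ.^ k) *ᶻ + 3
3^suc k = trans (cong +_ (ℕ.*-comm 3 (3 ℕ.^ k))) (ℤ.pos-* (3 ℕ.^ k) 3)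

-- The first `U` sends F to z and later ones each release a factor 3, hence k factors for k + 1
-- applications. The remaining factor stays hidden in m, whose membership in the span keeps the
-- induction going.
F-at-multiples : ∀ k → ∃ λ m → Span z m × (∀ n → F (n ℕ.* 3 ℕ.^ suc k) ≡ + (3 ℕ.^ k) *ᶻ m n)
F-at-multiples zero = z , generator , λ n →
  trans (sym (U-at 0 F n)) (trans (at U-F n) (sym (ℤ.*-identityˡ (z n))))
F-at-multiples (suc k) =
  let m , p , m-at = F-at-multiples k
      m′ , p′ , Um≈ = proj₁ (U-span-G (span-z⇒span-G p))
  in m′ , p′ , λ n → begin′
       F (n ℕ.* (3 ℕ.* 3 ℕ.^ suc k))           ≡⟨ cong F (ℕ.*-assoc n 3 (3 ℕ.^ suc k)) ⟨
       F (n ℕ.* 3 ℕ.* 3 ℕ.^ suc k)             ≡⟨ m-at (n ℕ.* 3) ⟩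
       + (3 ℕ.^ k) *ᶻ m (n ℕ.* 3)              ≡⟨ cong (+ (3 ℕ.^ k) *ᶻ_)
                                                    (trans (sym (U-at 0 m n)) (trans (at Um≈ n) (con-* (+ 3) m′ n))) ⟩
       + (3 ℕ.^ k) *ᶻ (+ 3 *ᶻ m′ n)            ≡⟨ ℤ.*-assoc (+ (3 ℕ.^ k)) (+ 3) (m′ n) ⟨
       + (3 ℕ.^ k) *ᶻ + 3 *ᶻ m′ n              ≡⟨ cong (_*ᶻ m′ n) (3^suc k) ⟨
       + (3 ℕ.^ suc k) *ᶻ m′ n                 ∎′
  where
  open ≡-Reasoning renaming (begin_ to begin′_; _∎ to _∎′)

a₉-divisible : ∀ α n → + (3 ℕ.^ suc α) ∣ a₉ (3 ℕ.^ suc α ℕ.* n ℕ.+ 3 ℕ.^ suc α ℕ.∸ 1)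
a₉-divisible α n =
  let m , p , m-at = F-at-multiples α
      w , m≈ = span-z-divisible p
  in ∣⇒∣ᵤ (divides (w (suc n)) (begin′
       a₉ (3 ℕ.^ suc α ℕ.* n ℕ.+ 3 ℕ.^ suc α ℕ.∸ 1)  ≡⟨ X-1-*-suc a₉ _ ⟨
       F (suc (3 ℕ.^ suc α ℕ.* n ℕ.+ 3 ℕ.^ suc α ℕ.∸ 1))  ≡⟨ cong F index ⟩
       F (suc n ℕ.* 3 ℕ.^ suc α)               ≡⟨ m-at (suc n) ⟩
       + (3 ℕ.^ α) *ᶻ m (suc n)                ≡⟨ cong (+ (3 ℕ.^ α) *ᶻ_) (trans (at m≈ (suc n)) (con-* (+ 3) w (suc n))) ⟩
       + (3 ℕ.^ α) *ᶻ (+ 3 *ᶻ w (suc n))       ≡⟨ ℤ.*-assoc (+ (3 ℕ.^ α)) (+ 3) (w (suc n)) ⟨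
       + (3 ℕ.^ α) *ᶻ + 3 *ᶻ w (suc n)         ≡⟨ cong (_*ᶻ w (suc n)) (3^suc α) ⟨
       + (3 ℕ.^ suc α) *ᶻ w (suc n)            ≡⟨ ℤ.*-comm (+ (3 ℕ.^ suc α)) (w (suc n)) ⟩
       w (suc n) *ᶻ + (3 ℕ.^ suc α)            ∎′))
  where
  open ≡-Reasoning renaming (begin_ to begin′_; _∎ to _∎′)
  -- `suc` undoes the truncated subtraction because the power of 3 is positive.
  index : suc (3 ℕ.^ suc α ℕ.* n ℕ.+ 3 ℕ.^ suc α ℕ.∸ 1) ≡ suc n ℕ.* 3 ℕ.^ suc α
  index = trans (ℕ.m+[n∸m]≡n (ℕ.≤-trans (ℕ.m^n>0 3 (suc α)) (ℕ.m≤n+m (3 ℕ.^ suc α) (3 ℕ.^ suc α ℕ.* n))))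
    (trans (ℕ.+-comm (3 ℕ.^ suc α ℕ.* n) _) (cong (3 ℕ.^ suc α ℕ.+_) (ℕ.*-comm (3 ℕ.^ suc α) n)))

theorem1p2 : (α n : ℕ) → + (3 ℕ.^ (α ℕ.+ 1)) ∣ a₉ (3 ℕ.^ (α ℕ.+ 1) ℕ.* n ℕ.+ 3 ℕ.^ (α ℕ.+ 1) ℕ.∸ 1)
theorem1p2 α n = subst (λ k → + (3 ℕ.^ k) ∣ a₉ (3 ℕ.^ k ℕ.* n ℕ.+ 3 ℕ.^ k ℕ.∸ 1))
  (ℕ.+-comm 1 α) (a₉-divisible α n)
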